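{- Let $p$ be a prime number, let $\theta\in\mathbb{F}_{p^{p}}$ satisfy $\theta^{p}=\theta+1$, and let $\mathrm{Tr}:\mathbb{F}_{p^{p}}\to\mathbb{F}_{p}$ be the trace map. Let $a,m\in\mathbb{Z}_{\geq 0}$ with $\gcd(a,p)=1$, and put $\tau_{p}(a):=\sum_{j=1}^{p-1} j\,p^{ja-1}$. Then \[ a^{m}b_{m}(a^{ -1}) \equiv -\mathrm{Tr}(\theta^{\tau_{p}(a)})\,\mathrm{Tr}(\theta^{m-1-\tau_{p}(a)}) \pmod{p}. \] In particular, $\mathrm{Tr}(\theta^{\zeta(\mathbb{F}_{p}, a)}) \equiv \mathrm{Tr}(\theta^{\tau_{p}(a)}) \equiv a^{\tau_{p}(a)}b_{\tau_{p}(a)}(a^{ -1}) \pmod{p}$.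
   Context: $S(n,j)$ is the Stirling number of the second kind (number of partitions of $\{1,\dots,n\}$ into $j$ non-empty subsets) and $b_n(x):=\sum_{j\ge0}S(n,j)x^j\in\mathbb{Z}[x]$ is the Bell polynomial. $a^{ -1}$ denotes the inverse of $a$ modulo $p$, and both sides are viewed in $\mathbb{F}_p$. Negative powers of $\theta$ are taken in $\mathbb{F}_{p^p}^\times$. Put $k_{p}:=(p^{p}-1)/(p-1)$; one has $\theta^{k_p}=1$. Since $p$ is a unit modulo $k_p$ and $1-p^{ -a}$ is a unit modulo $k_p$ when $\gcd(a,p)=1$, $\zeta(\mathbb{F}_{p},a):=(1-p^{ -a})^{ -1}$ is a well-defined class in $\mathbb{Z}/k_p\mathbb{Z}$ and $\theta^{\zeta(\mathbb{F}_{p},a)}:=\theta^{Z}$ for any integer $Z$ in that class. -}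

module Defs where

open import Level using (Level; _⊔_)
open import Algebra.Bundles using (CommutativeRing)
open import Data.Nat as ℕ using (ℕ; zero; suc)
open import Data.Integer as ℤ using (ℤ; +_; -[1+_])
open import Data.Fin using (Fin)
open import Data.Product using (Σ; ∃; _×_)
open import Relation.Binary.PropositionalEquality using (_≡_)
open import Relation.Nullary using (¬_)

S : ℕ → ℕ → ℕ
S zero zero = 1
S zero (suc j) = 0
S (suc n) zero = 0
S (suc n) (suc j) = suc j ℕ.* S n (suc j) ℕ.+ S n j

sumℕ : (ℕ → ℕ) → ℕ → ℕ
sumℕ f zero = 0
sumℕ f (suc n) = sumℕ f n ℕ.+ f n

τ : ℕ → ℕ → ℕ
τ p a = sumℕ (λ i → suc i ℕ.* p ℕ.^ ((suc i ℕ.* a) ℕ.∸ 1)) (p ℕ.∸ 1)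

-- k_p = (p^p-1)/(p-1), written as the geometric sum Σ_{i<p} p^i
kp : ℕ → ℕ
kp p = sumℕ (λ i → p ℕ.^ i) p

module InRing {c ℓ : Level} (F : CommutativeRing c ℓ) where
  open CommutativeRing F

  pow : Carrier → ℕ → Carrier
  pow x zero = 1#
  pow x (suc n) = x * pow x n

  sumF : (ℕ → Carrier) → ℕ → Carrier
  sumF f zero = 0#
  sumF f (suc n) = sumF f n + f n

  -- canonical image of n in F (i.e. n mod p viewed in the prime field)
  ι : ℕ → Carrier
  ι zero = 0#
  ι (suc n) = 1# + ι n

  powℤ : Carrier → Carrier → ℤ → Carrier
  powℤ x xinv (+ n) = pow x n
  powℤ x xinv -[1+ n ] = pow xinv (suc n)

  -- Trace F_{p^p} → F_p : Tr(α) = Σ_{i<p} α^{p^i}  (valued in the prime field ⊆ F)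
  Tr : ℕ → Carrier → Carrier
  Tr p α = sumF (λ i → pow α (p ℕ.^ i)) p

  bell : ℕ → Carrier → Carrier
  bell m x = sumF (λ j → ι (S m j) * pow x j) (suc m)

  IsField : Set (c ⊔ ℓ)
  IsField = (¬ (1# ≈ 0#)) × (∀ x → ¬ (x ≈ 0#) → ∃ λ y → x * y ≈ 1#)

  HasCard : ℕ → Set (c ⊔ ℓ)
  HasCard q = Σ (Fin q → Carrier) λ f →
    (∀ i j → f i ≈ f j → i ≡ j) × (∀ x → ∃ λ i → f i ≈ x)

{-# OPTIONS --safe #-}
-- Tr (θ^k) is the sum of (θ + i)^k over i ∈ 𝔽_p, because Frobenius acts by θ ↦ θ + 1.
-- Let σ be the a-th power of Frobenius, β = θ^τ and γ = 1/(θβ). The choice of τ, together with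
-- Π_{j<p} (θ + ja) = 1, gives σ β = θ β, hence σ γ · (θ + a) = γ, so σ maps
-- γ θ (θ - a) ⋯ (θ - j a) to γ θ (θ - a) ⋯ (θ - (j-1) a): all these elements have trace
-- Tr γ. Expanding θ^m through Stirling numbers in the basis θ (θ - a) ⋯ (θ - (j-1) a) yields Tr (γ θ^m) = a^m b_m(1/a) Tr γ.
-- For the normalisation, Tr β = Σ_j σ^j β = Σ_{j<p} θ (θ + a) ⋯ (θ + (j-1) a) β, so that
-- Tr β · γ = 1/θ + (a polynomial in θ of degree < p - 1), and Tr β · Tr γ = Tr (1/θ) = -1.
module Submission where

open import Defs
open import Level using (Level)
open import Algebra.Bundles using (CommutativeRing)
open import Data.Nat as ℕ using (ℕ; zero; suc; _<_)
open import Data.Nat.GCD using (gcd)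
open import Data.Nat.Primality using (Prime; ¬prime[0])
open import Relation.Binary.PropositionalEquality as ≡ using (_≡_)
open import Relation.Nullary using (contradiction)

-- In the exponents of θ, τ is 1/(p^a - 1): summation by parts gives τ p^a = τ + 1 there. Since ζ =
-- 1/(1 - p^(-a)) = p^a/(p^a - 1), this makes ζ = p^a τ, so θ^ζ is the conjugate σ β of β. The
-- explicit traces rest on one fact: for arbitrary y_k, the sum over i in 𝔽_p of a product of m
-- factors i + y_k is 0 if m < p - 1 and -1 if m = p - 1. It is proved without polynomials, by
-- trading the factors for falling factorials. Applied to the conjugates θ + i, it yields Tr (1/θ),
-- the vanishing of the polynomial part, and even Π (θ + ja) = 1. Everything takes place inside F:
-- scalars are the elements fixed by Frobenius, and x^(p^p) = x is carried along for the elements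
-- built from θ.

module Arithmetic where

  -- Inverses modulo p and permutations of the residues

  open import Data.Nat using (_+_; _*_; _^_; _∸_; s≤s; NonZero)
  open import Data.Nat.Properties
  open import Data.Nat.Divisibility using (_∣_; divides; ∣⇒≤; _∤_; ∣1⇒≡1)
  open import Data.Nat.Combinatorics using (_C_; nCk≡n!/k![n-k]!; k![n∸k]!∣n!)
  open import Data.Nat.DivMod using (_%_; m/n*n≡m; m%n<n; [m+kn]%n≡m%n; m<n⇒m%n≡m; %-distribˡ-*; m%n%n≡m%n)
  open import Data.Nat.Base using (_!)
  open import Data.Nat.Primality using (euclidsLemma; ¬prime[1])
  open import Data.Nat.Coprimality using (gcd≡1⇒coprime; coprime-Bézout)
  open import Data.Nat.GCD using (module Bézout)
  open import Data.Nat.Tactic.RingSolver using (solve-∀)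
  open import Data.Fin using (Fin; toℕ; fromℕ<)
  open import Data.Fin.Properties using (toℕ-injective; toℕ-fromℕ<; toℕ<n)
  open import Data.Fin.Permutation using (Permutation′; permutation)
  open import Data.Product using (∃-syntax; _,_)
  open import Data.Sum using (inj₁; inj₂)
  open import Relation.Binary.PropositionalEquality
    using (refl; sym; trans; cong; cong₂; subst; module ≡-Reasoning)

  -- The congruence a b ≡ 1 (mod p) has multiples of p on both sides, so that either sign in
  -- Bézout's identity fits without subtraction.
  inverse-mod : ∀ {a p} → gcd a p ≡ 1 → ∃[ b ] ∃[ c ] ∃[ d ] a * b + c * p ≡ 1 + d * p
  inverse-mod {a} {p} g≡1 with coprime-Bézout (gcd≡1⇒coprime {a} {p} g≡1)
  ... | Bézout.+- x y eq = x , 0 , y , trans (+-identityʳ _) (trans (*-comm a x) (sym eq))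
  ... | Bézout.-+ x y eq with p
  ...   | zero  = contradiction (trans eq (*-zeroʳ y)) λ ()
  -- Here 1 + x a = y p, so the inverse is -x, represented by x (p - 1).
  ...   | suc n = x * n , y , a * x , (begin
    a * (x * n) + y * suc n          ≡⟨ cong (λ k → a * (x * n) + k) eq ⟨
    a * (x * n) + (1 + x * a)        ≡⟨ lemma a x n ⟩
    1 + a * x * suc n                ∎)
    where
    open ≡-Reasoning
    lemma : ∀ a x n → a * (x * n) + (1 + x * a) ≡ 1 + a * x * suc n
    lemma = solve-∀

  module _ {p : ℕ} .{{_ : NonZero p}} where
    open ≡-Reasoning

    inverse-mod-% : ∀ {a b c d} → a * b + c * p ≡ 1 + d * p →
                    ∀ {i} → i < p → ((i * a) % p * b) % p ≡ i
    inverse-mod-% {a} {b} {c} {d} ab {i} i<p = begin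
      ((i * a) % p * b) % p                    ≡⟨ %-distribˡ-* ((i * a) % p) b p ⟩
      ((i * a) % p % p * (b % p)) % p          ≡⟨ cong (λ x → (x * (b % p)) % p) (m%n%n≡m%n (i * a) p) ⟩
      ((i * a) % p * (b % p)) % p              ≡⟨ %-distribˡ-* (i * a) b p ⟨
      (i * a * b) % p                          ≡⟨ [m+kn]%n≡m%n (i * a * b) (i * c) p ⟨
      (i * a * b + i * c * p) % p              ≡⟨ cong (_% p) (lemma₁ i a b c p) ⟩
      (i * (a * b + c * p)) % p                ≡⟨ cong (λ x → (i * x) % p) ab ⟩
      (i * (1 + d * p)) % p                    ≡⟨ cong (_% p) (lemma₂ i d p) ⟩
      (i + i * d * p) % p                      ≡⟨ [m+kn]%n≡m%n i (i * d) p ⟩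
      i % p                                    ≡⟨ m<n⇒m%n≡m i<p ⟩
      i                                        ∎
      where
      lemma₁ : ∀ i a b c p → i * a * b + i * c * p ≡ i * (a * b + c * p)
      lemma₁ = solve-∀
      lemma₂ : ∀ i d p → i * (1 + d * p) ≡ i + i * d * p
      lemma₂ = solve-∀

    scale : ℕ → Fin p → Fin p
    scale a i = fromℕ< (m%n<n (toℕ i * a) p)

    toℕ-scale : ∀ a i → toℕ (scale a i) ≡ (toℕ i * a) % p
    toℕ-scale a i = toℕ-fromℕ< (m%n<n (toℕ i * a) p)

    scale-inverse : ∀ {a b c d} → a * b + c * p ≡ 1 + d * p → ∀ i → scale b (scale a i) ≡ i
    scale-inverse {a} {b} {c} {d} ab i = toℕ-injective (begin
      toℕ (scale b (scale a i))         ≡⟨ toℕ-scale b (scale a i) ⟩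
      (toℕ (scale a i) * b) % p         ≡⟨ cong (λ x → (x * b) % p) (toℕ-scale a i) ⟩
      ((toℕ i * a) % p * b) % p         ≡⟨ inverse-mod-% {a} {b} {c} {d} ab (toℕ<n i) ⟩
      toℕ i                             ∎)

    scaling : ∀ {a b c d} → a * b + c * p ≡ 1 + d * p → Permutation′ p
    scaling {a} {b} {c} {d} ab = permutation (scale a) (scale b)
      (scale-inverse {b} {a} {c} {d} (trans (cong (_+ c * p) (*-comm b a)) ab))
      (scale-inverse {a} {b} {c} {d} ab)

  -- Divisibility of binomial coefficients

  prime∤! : ∀ {p} → Prime p → ∀ {k} → k < p → p ∤ k !
  prime∤! pr {zero}  k<p p∣1 = contradiction (subst Prime (∣1⇒≡1 p∣1) pr) ¬prime[1]
  prime∤! pr {suc k} k<p p∣! with euclidsLemma (suc k) (k !) pr p∣!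
  ... | inj₁ p∣k = contradiction (∣⇒≤ p∣k) (<⇒≱ k<p)
  ... | inj₂ p∣! = prime∤! pr (<-trans (n<1+n k) k<p) p∣!

  -- p divides p! = (p C k) k! (p - k)! but neither factorial, both being products of numbers below
  -- p.
  prime∣binomial : ∀ {p} → Prime p → ∀ {k} → 0 < k → k < p → p ∣ p C k
  prime∣binomial {p} pr {k} 0<k k<p with euclidsLemma (p C k) (k ! * (p ∸ k) !) pr p∣product
    where
    instance _ = (k !* (p ∸ k) !≢0)
    p∣product : p ∣ (p C k) * (k ! * (p ∸ k) !)
    p∣product = subst (p ∣_)
      (sym (trans (cong (_* (k ! * (p ∸ k) !)) (nCk≡n!/k![n-k]! (<⇒≤ k<p)))
                  (m/n*n≡m (k![n∸k]!∣n! (<⇒≤ k<p)))))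
      (p∣p! pr)
      where
      p∣p! : ∀ {p} → Prime p → p ∣ p !
      p∣p! {suc n} _ = divides (n !) (*-comm (suc n) (n !))
  ... | inj₁ p∣C = p∣C
  ... | inj₂ p∣k![p∸k]! with euclidsLemma (k !) ((p ∸ k) !) pr p∣k![p∸k]!
  ...   | inj₁ p∣! = contradiction p∣! (prime∤! pr k<p)
  ...   | inj₂ p∣! = contradiction p∣! (prime∤! pr (∸-monoʳ-< 0<k (<⇒≤ k<p)))

  -- Falling factorials (i)_l and the arithmetic of τ

  falling : ℕ → ℕ → ℕ
  falling zero    i       = 1
  falling (suc l) zero    = 0
  falling (suc l) (suc i) = suc i * falling l i

  -- Subtraction-free form of (i - l) (i)_l = (i)_{l+1}.
  *-falling : ∀ l i → i * falling l i ≡ l * falling l i + falling (suc l) i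
  *-falling zero    zero    = refl
  *-falling zero    (suc i) = refl
  *-falling (suc l) zero    = sym (trans (+-identityʳ _) (*-zeroʳ l))
  *-falling (suc l) (suc i) = begin
    suc i * (suc i * f)                    ≡⟨⟩
    suc i * (f + i * f)                    ≡⟨ cong (λ x → suc i * (f + x)) (*-falling l i) ⟩
    suc i * (f + (l * f + falling (suc l) i)) ≡⟨ lemma i l f (falling (suc l) i) ⟩
    suc l * (suc i * f) + suc i * falling (suc l) i ∎
    where
    open ≡-Reasoning
    f = falling l i
    lemma : ∀ i l f g → suc i * (f + (l * f + g)) ≡ suc l * (suc i * f) + suc i * g
    lemma = solve-∀

  -- The telescoping identity Δ (i)_{l+1} = (l+1) (i)_l, summed.
  sum-falling : ∀ l n → suc l * sumℕ (falling l) n ≡ falling (suc l) n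
  sum-falling l zero    = *-zeroʳ l
  sum-falling l (suc n) = begin
    suc l * (sumℕ (falling l) n + f)          ≡⟨ *-distribˡ-+ (suc l) (sumℕ (falling l) n) f ⟩
    suc l * sumℕ (falling l) n + suc l * f    ≡⟨ cong (_+ suc l * f) (sum-falling l n) ⟩
    falling (suc l) n + (f + l * f)           ≡⟨ lemma (falling (suc l) n) f (l * f) ⟩
    f + (l * f + falling (suc l) n)           ≡⟨ cong (λ k → f + k) (*-falling l n) ⟨
    suc n * f                                 ∎
    where
    open ≡-Reasoning
    f = falling l n
    lemma : ∀ x y z → x + (y + z) ≡ y + (z + x)
    lemma = solve-∀

  S-vanish : ∀ {n j} → n < j → S n j ≡ 0
  S-vanish {zero}  {suc j} _         = refl
  S-vanish {suc n} {suc j} (s≤s n<j) =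
    trans (cong₂ (λ x y → suc j * x + y) (S-vanish (<-trans n<j (n<1+n j))) (S-vanish n<j))
          (trans (+-identityʳ _) (*-zeroʳ (suc j)))

  -- Summation by parts: multiplying by q moves the weight i + 1 from `e i` to `e (suc i)`; one
  -- extra copy of each `e i` then restores its weight i + 1.
  sum-geometric : ∀ (e : ℕ → ℕ) q → (∀ i → e (suc i) ≡ e i * q) → ∀ n →
    sumℕ (λ i → suc i * e i) n * q + sumℕ e (suc n) ≡ sumℕ (λ i → suc i * e i) n + suc n * e n
  sum-geometric e q eq zero    = sym (+-identityʳ _)
  sum-geometric e q eq (suc n) = begin
    (s + suc n * e n) * q + (t + e (suc n))    ≡⟨ lemma₁ s n (e n) q t (e (suc n)) ⟩
    (s * q + t) + suc n * (e n * q) + e (suc n) ≡⟨ cong₂ (λ x y → x + suc n * y + e (suc n)) (sum-geometric e q eq n) (sym (eq n)) ⟩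
    s + suc n * e n + suc n * e (suc n) + e (suc n) ≡⟨ lemma₂ (s + suc n * e n) n (e (suc n)) ⟩
    s + suc n * e n + suc (suc n) * e (suc n)  ∎
    where
    open ≡-Reasoning
    s = sumℕ (λ i → suc i * e i) n
    t = sumℕ e (suc n)
    lemma₁ : ∀ s n x q t y → (s + suc n * x) * q + (t + y) ≡ (s * q + t) + suc n * (x * q) + y
    lemma₁ = solve-∀
    lemma₂ : ∀ s n y → s + suc n * y + y ≡ s + suc (suc n) * y
    lemma₂ = solve-∀

  -- The boundary term is p * p^(pa-1) = p^(pa), and θ^(p^(pa)) = θ: the -1 in the exponents of τ
  -- compensates the factor p. Positivity of a keeps `∸` exact.
  τ-identity : ∀ n {a} → 0 < a →
    τ (suc n) a * suc n ^ a + sumℕ (λ i → suc n ^ (suc i * a ∸ 1)) (suc n) ≡ τ (suc n) a + suc n ^ (suc n * a)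
  τ-identity n {suc a} _ = sum-geometric (λ i → p ^ (a + i * suc a)) (p ^ suc a) step n
    where
    p = suc n
    step : ∀ i → p ^ (a + suc i * suc a) ≡ p ^ (a + i * suc a) * p ^ suc a
    step i = trans (cong (p ^_) (lemma a i)) (^-distribˡ-+-* p (a + i * suc a) (suc a))
      where
      lemma : ∀ a i → a + suc i * suc a ≡ a + i * suc a + suc a
      lemma = solve-∀

open import Data.Integer as ℤ using (ℤ; +_; -[1+_])
open import Data.Integer.Divisibility using (_∣_)

-- Sums, products and powers in a commutative ring

module RingFacts {c ℓ : Level} (F : CommutativeRing c ℓ) where
  open CommutativeRing F hiding (zero)
  open InRing F
  open Arithmetic
  open import Algebra.Properties.CommutativeSemiring.Exp commutativeSemiring
  open import Algebra.Properties.Semiring.Mult semiring using (_×_; ×-homo-+; ×-assocˡ; ×1-homo-*; ×-congʳ)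
  open import Algebra.Properties.Semiring.Sum semiring using (sum; sum-permute; sum-cong-≋; ∑-distrib-+; sum-init-last; sum-replicate; sum-replicate-zero)
  open import Algebra.Properties.Ring ring using (+-cancelʳ; +-cancelˡ; -‿injective; -‿distribʳ-*; -‿involutive)
  open import Algebra.Properties.CommutativeSemiring.Binomial commutativeSemiring using () renaming (theorem to binomial-theorem)
  open import Algebra.Solver.Ring.NaturalCoefficients.Default commutativeSemiring
  open import Relation.Binary.Reasoning.Setoid setoid
  open import Data.Nat.Properties as ℕₚ using (n<1+n; <-trans)
  open import Data.Nat.Divisibility using () renaming (_∣_ to _∣ℕ_; divides to dividesℕ)
  open import Data.Nat.Coprimality as Coprimality using (prime⇒coprime; coprime⇒gcd≡1; 1-coprimeTo)
  open import Data.Nat.Primality using (¬prime[1])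
  open import Data.Integer.Properties as ℤₚ using ([1+m]⊖[1+n]≡m⊖n)
  open import Data.Integer.Divisibility.Signed using (∣ᵤ⇒∣; divides)
  open import Data.Fin using (Fin; zero; suc; toℕ; fromℕ; inject₁)
  open import Data.Fin.Permutation using (Permutation′; permutation; _⟨$⟩ʳ_)
  open import Data.Fin.Properties as Finₚ using (toℕ-fromℕ; toℕ-inject₁; toℕ<n)
  open import Data.Product using (∃; _,_; proj₁; proj₂)
  open import Function using (_∘_)
  open import Relation.Nullary using (Dec; yes; no)

  pow≡^ : ∀ x n → pow x n ≡ x ^ n
  pow≡^ x zero    = ≡.refl
  pow≡^ x (suc n) = ≡.cong (x *_) (pow≡^ x n)

  pow-cong : ∀ n {x y} → x ≈ y → pow x n ≈ pow y n
  pow-cong zero    x≈y = refl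
  pow-cong (suc n) x≈y = *-cong x≈y (pow-cong n x≈y)

  pow-+ : ∀ x m n → pow x (m ℕ.+ n) ≈ pow x m * pow x n
  pow-+ x m n rewrite pow≡^ x (m ℕ.+ n) | pow≡^ x m | pow≡^ x n = ^-homo-* x m n

  pow-pow : ∀ x m n → pow (pow x m) n ≈ pow x (m ℕ.* n)
  pow-pow x m n rewrite pow≡^ x (m ℕ.* n) | pow≡^ x m | pow≡^ (x ^ m) n = ^-assocʳ x m n

  pow-distrib-* : ∀ x y n → pow (x * y) n ≈ pow x n * pow y n
  pow-distrib-* x y n rewrite pow≡^ (x * y) n | pow≡^ x n | pow≡^ y n = ^-distrib-* x y n

  pow-1# : ∀ n → pow 1# n ≈ 1#
  pow-1# zero    = refl
  pow-1# (suc n) = trans (*-identityˡ _) (pow-1# n)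

  ι≡× : ∀ n → ι n ≡ n × 1#
  ι≡× zero    = ≡.refl
  ι≡× (suc n) = ≡.cong (λ x → 1# + x) (ι≡× n)

  ι-+ : ∀ m n → ι (m ℕ.+ n) ≈ ι m + ι n
  ι-+ m n rewrite ι≡× (m ℕ.+ n) | ι≡× m | ι≡× n = ×-homo-+ 1# m n

  ι-* : ∀ m n → ι (m ℕ.* n) ≈ ι m * ι n
  ι-* m n rewrite ι≡× (m ℕ.* n) | ι≡× m | ι≡× n = ×1-homo-* m n

  ι-1 : ι 1 ≈ 1#
  ι-1 = +-identityʳ 1#

  ι-^ : ∀ m n → ι (m ℕ.^ n) ≈ pow (ι m) n
  ι-^ m zero    = ι-1
  ι-^ m (suc n) = trans (ι-* m (m ℕ.^ n)) (*-congˡ (ι-^ m n))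

  sumF-cong : ∀ {f g} n → (∀ {i} → i < n → f i ≈ g i) → sumF f n ≈ sumF g n
  sumF-cong zero    f≈g = refl
  sumF-cong (suc n) f≈g = +-cong (sumF-cong n (λ i<n → f≈g (<-trans i<n (n<1+n n)))) (f≈g (n<1+n n))

  sumF-zero : ∀ {f} n → (∀ {i} → i < n → f i ≈ 0#) → sumF f n ≈ 0#
  sumF-zero zero    f≈0 = refl
  sumF-zero (suc n) f≈0 = trans
    (+-cong (sumF-zero n (λ i<n → f≈0 (<-trans i<n (n<1+n n)))) (f≈0 (n<1+n n))) (+-identityʳ 0#)

  sumF-+ : ∀ f g n → sumF (λ i → f i + g i) n ≈ sumF f n + sumF g n
  sumF-+ f g zero    = sym (+-identityʳ 0#)
  sumF-+ f g (suc n) = trans (+-congʳ (sumF-+ f g n))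
    (solve 4 (λ a b c d → (a :+ b) :+ (c :+ d) := (a :+ c) :+ (b :+ d)) refl _ _ _ _)

  *-distribˡ-sumF : ∀ x f n → x * sumF f n ≈ sumF (λ i → x * f i) n
  *-distribˡ-sumF x f zero    = zeroʳ x
  *-distribˡ-sumF x f (suc n) = trans (distribˡ x _ _) (+-congʳ (*-distribˡ-sumF x f n))

  *-distribʳ-sumF : ∀ x f n → sumF f n * x ≈ sumF (λ i → f i * x) n
  *-distribʳ-sumF x f zero    = zeroˡ x
  *-distribʳ-sumF x f (suc n) = trans (distribʳ x _ _) (+-congʳ (*-distribʳ-sumF x f n))

  sumF-head : ∀ f n → sumF f (suc n) ≈ f 0 + sumF (f ∘ suc) n
  sumF-head f zero    = +-comm 0# (f 0)
  sumF-head f (suc n) = trans (+-congʳ (sumF-head f n)) (+-assoc _ _ _)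

  sumF-const : ∀ x n → sumF (λ _ → x) n ≈ ι n * x
  sumF-const x zero    = sym (zeroˡ x)
  sumF-const x (suc n) = trans (+-congʳ (sumF-const x n))
    (solve 2 (λ n x → n :* x :+ x := (con 1 :+ n) :* x) refl (ι n) x)

  sumF≈sum : ∀ f n → sumF f n ≈ sum {n} (f ∘ toℕ)
  sumF≈sum f zero    = refl
  sumF≈sum f (suc n) = trans (sumF-head f n) (+-congˡ (sumF≈sum (f ∘ suc) n))

  ι-sum : ∀ f n → ι (sumℕ f n) ≈ sumF (ι ∘ f) n
  ι-sum f zero    = refl
  ι-sum f (suc n) = trans (ι-+ (sumℕ f n) (f n)) (+-congʳ (ι-sum f n))

  prodF : (ℕ → Carrier) → ℕ → Carrier
  prodF f zero    = 1#
  prodF f (suc n) = prodF f n * f n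

  prodF-cong : ∀ {f g} n → (∀ i → f i ≈ g i) → prodF f n ≈ prodF g n
  prodF-cong zero    f≈g = refl
  prodF-cong (suc n) f≈g = *-cong (prodF-cong n f≈g) (f≈g n)

  prodF-head : ∀ f n → prodF f (suc n) ≈ f 0 * prodF (f ∘ suc) n
  prodF-head f zero    = *-comm 1# (f 0)
  prodF-head f (suc n) = trans (*-congʳ (prodF-head f n)) (*-assoc _ _ _)

  pow-prodF : ∀ f m n → pow (prodF f n) m ≈ prodF (λ i → pow (f i) m) n
  pow-prodF f m zero    = pow-1# m
  pow-prodF f m (suc n) = trans (pow-distrib-* _ _ m) (*-congʳ (pow-prodF f m n))

  pow-sumℕ : ∀ x f n → pow x (sumℕ f n) ≈ prodF (λ i → pow x (f i)) n
  pow-sumℕ x f zero    = refl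
  pow-sumℕ x f (suc n) = trans (pow-+ x (sumℕ f n) (f n)) (*-congʳ (pow-sumℕ x f n))

  *-cancelˡ-invertible : ∀ {u v x y} → u * v ≈ 1# → u * x ≈ u * y → x ≈ y
  *-cancelˡ-invertible {u} {v} {x} {y} uv ux≈uy = begin
    x             ≈⟨ *-identityˡ x ⟨
    1# * x        ≈⟨ *-congʳ uv ⟨
    u * v * x     ≈⟨ swap x ⟩
    v * (u * x)   ≈⟨ *-congˡ ux≈uy ⟩
    v * (u * y)   ≈⟨ swap y ⟨
    u * v * y     ≈⟨ *-congʳ uv ⟩
    1# * y        ≈⟨ *-identityˡ y ⟩
    y             ∎
    where
    swap : ∀ z → u * v * z ≈ v * (u * z)
    swap = solve 3 (λ u v z → u :* v :* z := v :* (u :* z)) refl u v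

  -- Functions on ℤ/p as p-periodic functions on ℕ

  module Periodic {p : ℕ} {f : ℕ → Carrier} (periodic : ∀ i → f (p ℕ.+ i) ≈ f i) where

    sumF-shift : sumF (f ∘ suc) p ≈ sumF f p
    sumF-shift = +-cancelʳ (f 0) _ _ (begin
      sumF (f ∘ suc) p + f 0   ≈⟨ +-comm _ _ ⟩
      f 0 + sumF (f ∘ suc) p   ≈⟨ sumF-head f p ⟨
      sumF f p + f p           ≈⟨ +-congˡ (reflexive (≡.cong f (≡.sym (ℕₚ.+-identityʳ p)))) ⟩
      sumF f p + f (p ℕ.+ 0)   ≈⟨ +-congˡ (periodic 0) ⟩
      sumF f p + f 0           ∎)

    periodic-* : ∀ k i → f (i ℕ.+ k ℕ.* p) ≈ f i
    periodic-* zero    i = reflexive (≡.cong f (ℕₚ.+-identityʳ i))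
    periodic-* (suc k) i = trans (reflexive (≡.cong f (lemma i p (k ℕ.* p)))) (trans (periodic _) (periodic-* k i))
      where
      lemma : ∀ i p m → i ℕ.+ (p ℕ.+ m) ≡ p ℕ.+ (i ℕ.+ m)
      lemma i p m = ≡.trans (≡.sym (ℕₚ.+-assoc i p m)) (≡.trans (≡.cong (ℕ._+ m) (ℕₚ.+-comm i p)) (ℕₚ.+-assoc p i m))

    periodic-% : .{{_ : ℕ.NonZero p}} → ∀ i → f (i ℕ.% p) ≈ f i
    periodic-% i = sym (trans (reflexive (≡.cong f (m≡m%n+[m/n]*n i p))) (periodic-* (i ℕ./ p) (i ℕ.% p)))
      where open import Data.Nat.DivMod using (m≡m%n+[m/n]*n)

    sumF-scale : .{{_ : ℕ.NonZero p}} → ∀ {a b c d} → a ℕ.* b ℕ.+ c ℕ.* p ≡ 1 ℕ.+ d ℕ.* p →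
                 sumF (λ i → f (i ℕ.* a)) p ≈ sumF f p
    sumF-scale {a} {b} {c} {d} ab = begin
      sumF (λ i → f (i ℕ.* a)) p                ≈⟨ sumF≈sum (λ i → f (i ℕ.* a)) p ⟩
      sum {p} (λ i → f (toℕ i ℕ.* a))           ≈⟨ sum-cong-≋ (λ i → trans (sym (periodic-% (toℕ i ℕ.* a))) (reflexive (≡.cong f (≡.sym (toℕ-scale a i))))) ⟩
      sum {p} (λ i → f (toℕ (π ⟨$⟩ʳ i)))        ≈⟨ sum-permute (f ∘ toℕ) π ⟨
      sum {p} (f ∘ toℕ)                         ≈⟨ sumF≈sum f p ⟨
      sumF f p                                  ∎
      where π = scaling {p} {a} {b} {c} {d} ab

  -- Finite fields: decidable equality and characteristic

  module _ {q : ℕ} (finite : HasCard q) where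
    private
      element = proj₁ finite
      distinct = proj₁ (proj₂ finite)
      index : Carrier → Fin q
      index x = proj₁ (proj₂ (proj₂ finite) x)
      element-index : ∀ x → element (index x) ≈ x
      element-index x = proj₂ (proj₂ (proj₂ finite) x)

    -- `IsField` inverts only elements known to differ from 0, so excluding nilpotents requires a
    -- decision whether x ≈ 0.
    finite⇒dec : ∀ x y → Dec (x ≈ y)
    finite⇒dec x y with index x Finₚ.≟ index y
    ... | yes i≡j = yes (trans (sym (element-index x)) (trans (reflexive (≡.cong element i≡j)) (element-index y)))
    ... | no  i≢j = no λ x≈y → i≢j (distinct _ _ (trans (element-index x) (trans x≈y (sym (element-index y)))))

    -- Translation by 1 permutes the ring, so the sum of all elements absorbs q · 1.
    finite⇒ι-card : ι q ≈ 0#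
    finite⇒ι-card = +-cancelʳ (sum element) _ _ (begin
      ι q + sum element                   ≈⟨ +-comm _ _ ⟩
      sum element + ι q                   ≈⟨ +-congˡ (reflexive (ι≡× q)) ⟩
      sum element + q × 1#                ≈⟨ +-congˡ (sum-replicate q) ⟨
      sum element + sum {q} (λ _ → 1#)    ≈⟨ ∑-distrib-+ element (λ _ → 1#) ⟨
      sum (λ i → element i + 1#)          ≈⟨ sum-cong-≋ (λ i → element-index (element i + 1#)) ⟨
      sum (λ i → element (π ⟨$⟩ʳ i))      ≈⟨ sum-permute element π ⟨
      sum element                         ≈⟨ +-identityˡ _ ⟨
      0# + sum element                    ∎)
      where
      translate : Carrier → Fin q → Fin q
      translate x i = index (element i + x)
      translate-inverse : ∀ {x y} → x + y ≈ 0# → ∀ i → translate y (translate x i) ≡ i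
      translate-inverse {x} {y} xy i = distinct _ _ (begin
        element (translate y (translate x i))  ≈⟨ element-index _ ⟩
        element (translate x i) + y            ≈⟨ +-congʳ (element-index _) ⟩
        element i + x + y                      ≈⟨ +-assoc _ _ _ ⟩
        element i + (x + y)                    ≈⟨ +-congˡ xy ⟩
        element i + 0#                         ≈⟨ +-identityʳ _ ⟩
        element i                              ∎)
      π : Permutation′ q
      π = permutation (translate 1#) (translate (- 1#))
        (translate-inverse (-‿inverseˡ 1#)) (translate-inverse (-‿inverseʳ 1#))

    pow≈0⇒≈0 : IsField → ∀ {x} n → pow x n ≈ 0# → x ≈ 0#
    pow≈0⇒≈0 (1≉0 , _)   zero    1≈0  = contradiction 1≈0 1≉0
    pow≈0⇒≈0 fld@(_ , inv) {x} (suc n) xⁿ⁺¹≈0 with finite⇒dec x 0#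
    ... | yes x≈0 = x≈0
    ... | no  x≉0 = pow≈0⇒≈0 fld n (*-cancelˡ-invertible (proj₂ (inv x x≉0)) (trans xⁿ⁺¹≈0 (sym (zeroʳ x))))

    -- From q · 1 = 0 with q = p^n follows (p · 1)^n = 0, and a field has no nonzero nilpotents.
    card-p^⇒char-p : IsField → ∀ p n → q ≡ p ℕ.^ n → ι p ≈ 0#
    card-p^⇒char-p fld p n ≡.refl = pow≈0⇒≈0 fld n (trans (sym (ι-^ p n)) finite⇒ι-card)

  -- Characteristic p: Frobenius, the prime field and the trace

  freshman's-dream : ∀ {p} → Prime p → ι p ≈ 0# → ∀ x y → pow (x + y) p ≈ pow x p + pow y p
  freshman's-dream {suc n} pr char x y = begin
    pow (x + y) p                                        ≈⟨ reflexive (pow≡^ (x + y) p) ⟩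
    (x + y) ^ p                                          ≈⟨ binomial-theorem p x y ⟩
    term zero + sum {p} (term ∘ suc)                     ≈⟨ +-congˡ (sum-init-last {n} (term ∘ suc)) ⟩
    term zero + (sum {n} (λ i → term (suc (inject₁ i))) + term (suc (fromℕ n)))
      ≈⟨ +-congˡ (+-congʳ (trans (sum-cong-≋ middle) (sum-replicate-zero n))) ⟩
    term zero + (0# + term (suc (fromℕ n)))              ≈⟨ +-cong first (trans (+-identityˡ _) last) ⟩
    y ^ p + x ^ p                                        ≈⟨ +-comm _ _ ⟩
    x ^ p + y ^ p                                        ≡⟨ ≡.cong₂ _+_ (pow≡^ x p) (pow≡^ y p) ⟨
    pow x p + pow y p                                    ∎
    where
    open import Algebra.Properties.Semiring.Binomial semiring x y using (binomialTerm)
    open import Data.Nat.Combinatorics using (_C_; nCn≡1; nCk≡nC[n∸k])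
    p = suc n
    term = binomialTerm p
    p×≈0 : ∀ z → p × z ≈ 0#
    p×≈0 z = trans (lemma p z) (trans (*-congʳ (trans (reflexive (≡.sym (ι≡× p))) char)) (zeroˡ z))
      where
      lemma : ∀ m z → m × z ≈ (m × 1#) * z
      lemma zero    z = sym (zeroˡ z)
      lemma (suc m) z = trans (+-congˡ (lemma m z)) (solve 2 (λ m z → z :+ m :* z := (con 1 :+ m) :* z) refl (m × 1#) z)
    ∣⇒×≈0 : ∀ {m} → p ∣ℕ m → ∀ z → m × z ≈ 0#
    ∣⇒×≈0 (dividesℕ q ≡.refl) z = trans (sym (×-assocˡ z q p)) (trans (×-congʳ q (p×≈0 z)) (zero× q))
      where
      zero× : ∀ q → q × 0# ≈ 0#
      zero× zero    = refl
      zero× (suc q) = trans (+-identityˡ _) (zero× q)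
    middle : ∀ (i : Fin n) → term (suc (inject₁ i)) ≈ 0#
    middle i = ∣⇒×≈0 (prime∣binomial pr (ℕ.s≤s ℕ.z≤n)
      (ℕ.s≤s (≡.subst (_< n) (≡.sym (toℕ-inject₁ i)) (toℕ<n i)))) _
    first : term zero ≈ y ^ p
    first = trans (reflexive (≡.cong (_× (1# * y ^ p)) (≡.trans (nCk≡nC[n∸k] (ℕ.z≤n {p})) (nCn≡1 p))))
      (trans (+-identityʳ _) (*-identityˡ _))
    last : term (suc (fromℕ n)) ≈ x ^ p
    last = begin
      (p C suc (toℕ (fromℕ n))) × (x ^ suc (toℕ (fromℕ n)) * y ^ (n ℕ.∸ toℕ (fromℕ n)))
        ≡⟨ ≡.cong (λ k → (p C suc k) × (x ^ suc k * y ^ (n ℕ.∸ k))) (toℕ-fromℕ n) ⟩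
      (p C p) × (x ^ p * y ^ (n ℕ.∸ n))
        ≡⟨ ≡.cong₂ (λ j k → j × (x ^ p * y ^ k)) (nCn≡1 p) (ℕₚ.n∸n≡0 n) ⟩
      1 × (x ^ p * 1#)          ≈⟨ +-identityʳ _ ⟩
      x ^ p * 1#                ≈⟨ *-identityʳ _ ⟩
      x ^ p                     ∎

  module Characteristic {n : ℕ} (pr : Prime (suc n)) (char : ι (suc n) ≈ 0#) where
    private
      p = suc n

    -- Iterated Frobenius, kept as a bare power: `Tr p x` is then by definition the sum of `φ i x`
    -- over i < p.
    φ : ℕ → Carrier → Carrier
    φ i x = pow x (p ℕ.^ i)

    φ-cong : ∀ i {x y} → x ≈ y → φ i x ≈ φ i y
    φ-cong i = pow-cong (p ℕ.^ i)

    φ-* : ∀ i x y → φ i (x * y) ≈ φ i x * φ i y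
    φ-* i x y = pow-distrib-* x y (p ℕ.^ i)

    φ-1# : ∀ i → φ i 1# ≈ 1#
    φ-1# i = pow-1# (p ℕ.^ i)

    φ-zero : ∀ x → φ 0 x ≈ x
    φ-zero = *-identityʳ

    φ-φ : ∀ i j x → φ i (φ j x) ≈ φ (j ℕ.+ i) x
    φ-φ i j x = trans (pow-pow x (p ℕ.^ j) (p ℕ.^ i))
      (reflexive (≡.cong (pow x) (≡.sym (ℕₚ.^-distribˡ-+-* p j i))))

    φ-comm : ∀ i j x → φ i (φ j x) ≈ φ j (φ i x)
    φ-comm i j x = trans (φ-φ i j x)
      (trans (reflexive (≡.cong (λ k → φ k x) (ℕₚ.+-comm j i))) (sym (φ-φ j i x)))

    φ-one : ∀ x → φ 1 x ≈ pow x p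
    φ-one x = reflexive (≡.cong (pow x) (ℕₚ.*-identityʳ p))

    φ-suc : ∀ i x → φ (suc i) x ≈ φ i (φ 1 x)
    φ-suc i x = sym (φ-φ i 1 x)

    φ-+ : ∀ i x y → φ i (x + y) ≈ φ i x + φ i y
    φ-+ zero    x y = trans (φ-zero _) (sym (+-cong (φ-zero x) (φ-zero y)))
    φ-+ (suc i) x y = begin
      φ (suc i) (x + y)                ≈⟨ φ-suc i (x + y) ⟩
      φ i (φ 1 (x + y))                ≈⟨ φ-cong i (trans (φ-one _) (trans (freshman's-dream pr char x y) (sym (+-cong (φ-one x) (φ-one y))))) ⟩
      φ i (φ 1 x + φ 1 y)              ≈⟨ φ-+ i (φ 1 x) (φ 1 y) ⟩
      φ i (φ 1 x) + φ i (φ 1 y)        ≈⟨ +-cong (φ-suc i x) (φ-suc i y) ⟨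
      φ (suc i) x + φ (suc i) y        ∎

    φ-0# : ∀ i → φ i 0# ≈ 0#
    φ-0# i = +-cancelʳ (φ i 0#) _ _ (begin
      φ i 0# + φ i 0#   ≈⟨ φ-+ i 0# 0# ⟨
      φ i (0# + 0#)     ≈⟨ φ-cong i (+-identityˡ 0#) ⟩
      φ i 0#            ≈⟨ +-identityˡ _ ⟨
      0# + φ i 0#       ∎)

    φ-ι : ∀ i k → φ i (ι k) ≈ ι k
    φ-ι i zero    = φ-0# i
    φ-ι i (suc k) = trans (φ-+ i 1# (ι k)) (+-cong (φ-1# i) (φ-ι i k))

    φ-pow : ∀ i x k → φ i (pow x k) ≈ pow (φ i x) k
    φ-pow i x k = trans (pow-pow x k (p ℕ.^ i))
      (trans (reflexive (≡.cong (pow x) (ℕₚ.*-comm k (p ℕ.^ i)))) (sym (pow-pow x (p ℕ.^ i) k)))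

    φ-sumF : ∀ i f m → φ i (sumF f m) ≈ sumF (φ i ∘ f) m
    φ-sumF i f zero    = φ-0# i
    φ-sumF i f (suc m) = trans (φ-+ i _ _) (+-congʳ (φ-sumF i f m))

    φ-prodF : ∀ i f m → φ i (prodF f m) ≈ prodF (φ i ∘ f) m
    φ-prodF i f m = pow-prodF f (p ℕ.^ i) m

    -- 𝔽_p as the roots of x^p = x, so that a scalar needs no numeral representing it.
    InPrimeField : Carrier → Set ℓ
    InPrimeField x = φ 1 x ≈ x

    φ-prime-field : ∀ {x} → InPrimeField x → ∀ i → φ i x ≈ x
    φ-prime-field x∈ zero    = φ-zero _
    φ-prime-field x∈ (suc i) = trans (φ-suc i _) (trans (φ-cong i x∈) (φ-prime-field x∈ i))

    -- This equation makes the Frobenius iterates of x periodic modulo p; it starts from θ and 1/θ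
    -- and passes to products and powers.
    Fixed : Carrier → Set ℓ
    Fixed x = φ p x ≈ x

    Fixed-* : ∀ {x y} → Fixed x → Fixed y → Fixed (x * y)
    Fixed-* fx fy = trans (φ-* p _ _) (*-cong fx fy)

    Fixed-pow : ∀ {x} → Fixed x → ∀ k → Fixed (pow x k)
    Fixed-pow fx k = trans (φ-pow p _ k) (pow-cong k fx)

    Fixed-prodF : ∀ {f} → (∀ i → Fixed (f i)) → ∀ m → Fixed (prodF f m)
    Fixed-prodF {f} ff m = trans (φ-prodF p f m) (prodF-cong m ff)

    Fixed-φ : ∀ {x} → Fixed x → ∀ i → Fixed (φ i x)
    Fixed-φ fx i = trans (φ-comm p i _) (φ-cong i fx)

    module _ {x : Carrier} (fx : Fixed x) where

      φ-periodic : ∀ i → φ (p ℕ.+ i) x ≈ φ i x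
      φ-periodic i = trans (sym (φ-φ i p x)) (φ-cong i fx)

      open Periodic {p} {λ i → φ i x} φ-periodic

      φ-periodic-* : ∀ i k → φ (i ℕ.+ k ℕ.* p) x ≈ φ i x
      φ-periodic-* i k = periodic-* k i

      Tr-φ₁ : Tr p (φ 1 x) ≈ Tr p x
      Tr-φ₁ = trans (sumF-cong p (λ {i} _ → φ-φ i 1 x)) sumF-shift

      Tr-prime-field : InPrimeField (Tr p x)
      Tr-prime-field = trans (φ-sumF 1 _ p) (trans (sumF-cong p (λ {i} _ → φ-comm 1 i x)) Tr-φ₁)

      -- Multiplication by a permutes ℤ/p, so the trace may run over the iterates of `φ a`, for
      -- which the conjugates of β are explicit.
      Tr-scale : ∀ {a} → gcd a p ≡ 1 → sumF (λ i → φ (i ℕ.* a) x) p ≈ Tr p x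
      Tr-scale {a} a⊥p with inverse-mod {a} {p} a⊥p
      ... | b , c , d , eq = sumF-scale {a} {b} {c} {d} eq

      -- a generates ℤ/p: with a b ≡ 1 (mod p), the b-th iterate of `φ a` agrees with `φ 1` on x.
      φ-prime-field-generator : ∀ {a} → gcd a p ≡ 1 → φ a x ≈ x → InPrimeField x
      φ-prime-field-generator {a} a⊥p φx≈x with inverse-mod {a} {p} a⊥p
      ... | b , c , d , eq = begin
        φ 1 x                         ≈⟨ φ-periodic-* 1 d ⟨
        φ (1 ℕ.+ d ℕ.* p) x           ≡⟨ ≡.cong (λ k → φ k x) eq ⟨
        φ (a ℕ.* b ℕ.+ c ℕ.* p) x     ≈⟨ φ-periodic-* (a ℕ.* b) c ⟩
        φ (a ℕ.* b) x                 ≡⟨ ≡.cong (λ k → φ k x) (ℕₚ.*-comm a b) ⟩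
        φ (b ℕ.* a) x                 ≈⟨ iterate b ⟩
        x                             ∎
        where
        iterate : ∀ b → φ (b ℕ.* a) x ≈ x
        iterate zero    = φ-zero x
        iterate (suc b) = trans (sym (φ-φ (b ℕ.* a) a x)) (trans (φ-cong (b ℕ.* a) φx≈x) (iterate b))

    Tr-φ : ∀ {x} → Fixed x → ∀ k → Tr p (φ k x) ≈ Tr p x
    Tr-φ fx zero    = sumF-cong p (λ {i} _ → φ-cong i (φ-zero _))
    Tr-φ fx (suc k) = begin
      Tr p (φ (suc k) _)     ≈⟨ sumF-cong p (λ {i} _ → φ-cong i (φ-suc k _)) ⟩
      Tr p (φ k (φ 1 _))     ≈⟨ Tr-φ (Fixed-φ fx 1) k ⟩
      Tr p (φ 1 _)           ≈⟨ Tr-φ₁ fx ⟩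
      Tr p _                 ∎

    Tr-cong : ∀ {x y} → x ≈ y → Tr p x ≈ Tr p y
    Tr-cong x≈y = sumF-cong p (λ {i} _ → φ-cong i x≈y)

    Tr-+ : ∀ x y → Tr p (x + y) ≈ Tr p x + Tr p y
    Tr-+ x y = trans (sumF-cong p (λ {i} _ → φ-+ i x y)) (sumF-+ _ _ p)

    Tr-0# : Tr p 0# ≈ 0#
    Tr-0# = sumF-zero p (λ {i} _ → φ-0# i)

    Tr-sumF : ∀ f m → Tr p (sumF f m) ≈ sumF (Tr p ∘ f) m
    Tr-sumF f zero    = Tr-0#
    Tr-sumF f (suc m) = trans (Tr-+ _ _) (+-congʳ (Tr-sumF f m))

    Tr-*ˡ : ∀ {u} → InPrimeField u → ∀ x → Tr p (u * x) ≈ u * Tr p x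
    Tr-*ˡ {u} u∈ x = trans
      (sumF-cong p (λ {i} _ → trans (φ-* i u x) (*-congʳ (φ-prime-field u∈ i))))
      (sym (*-distribˡ-sumF u _ p))

    Tr-1# : Tr p 1# ≈ 0#
    Tr-1# = trans (sumF-cong p (λ {i} _ → φ-1# i)) (trans (sumF-const 1# p) (trans (*-congʳ char) (zeroˡ 1#)))

    φ-fixes-inverse : ∀ i {u v} → φ i u ≈ u → u * v ≈ 1# → φ i v ≈ v
    φ-fixes-inverse i {u} {v} φu uv = *-cancelˡ-invertible uv (begin
      u * φ i v          ≈⟨ *-congʳ φu ⟨
      φ i u * φ i v      ≈⟨ φ-* i u v ⟨
      φ i (u * v)        ≈⟨ trans (φ-cong i uv) (φ-1# i) ⟩
      1#                 ≈⟨ uv ⟨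
      u * v              ∎)

    InPrimeField-* : ∀ {u v} → InPrimeField u → InPrimeField v → InPrimeField (u * v)
    InPrimeField-* u∈ v∈ = trans (φ-* 1 _ _) (*-cong u∈ v∈)

    InPrimeField-pow : ∀ {u} → InPrimeField u → ∀ k → InPrimeField (pow u k)
    InPrimeField-pow u∈ k = trans (φ-pow 1 _ k) (pow-cong k u∈)

    -- Power sums over 𝔽_p

    ι-*p : ∀ k → ι (k ℕ.* p) ≈ 0#
    ι-*p k = trans (ι-* k p) (trans (*-congˡ char) (zeroʳ (ι k)))

    ι-invertible : ∀ {k} → 0 < k → k < p → ∃ λ v → ι k * v ≈ 1#
    ι-invertible {suc k} 0<k k<p with inverse-mod {suc k} {p} (coprime⇒gcd≡1 (Coprimality.sym (prime⇒coprime pr k<p)))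
    ... | b , c , d , eq = ι b , (begin
      ι (suc k) * ι b                    ≈⟨ ι-* (suc k) b ⟨
      ι (suc k ℕ.* b)                    ≈⟨ +-identityʳ _ ⟨
      ι (suc k ℕ.* b) + 0#               ≈⟨ +-congˡ (ι-*p c) ⟨
      ι (suc k ℕ.* b) + ι (c ℕ.* p)      ≈⟨ ι-+ (suc k ℕ.* b) (c ℕ.* p) ⟨
      ι (suc k ℕ.* b ℕ.+ c ℕ.* p)        ≡⟨ ≡.cong ι eq ⟩
      1# + ι (d ℕ.* p)                   ≈⟨ +-congˡ (ι-*p d) ⟩
      1# + 0#                            ≈⟨ +-identityʳ 1# ⟩
      1#                                 ∎)

    ι-cancelˡ : ∀ {k} → 0 < k → k < p → ∀ {x y} → ι k * x ≈ ι k * y → x ≈ y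
    ι-cancelˡ 0<k k<p with ι-invertible 0<k k<p
    ... | v , uv = *-cancelˡ-invertible uv

    -- Additivity of Frobenius gives k^p = k for every numeral, and the unit k cancels.
    fermat : ∀ {k} → 0 < k → k < p → pow (ι k) n ≈ 1#
    fermat {k} 0<k k<p = ι-cancelˡ 0<k k<p (trans (sym (φ-one (ι k))) (trans (φ-ι 1 k) (sym (*-identityʳ (ι k)))))

    -- By telescoping, (l+1) Σ (i)_l = (p)_{l+1} = p (p-1)_l, which is 0 in F, while l + 1 < p is
    -- invertible. At l = p - 1 the factor would be p itself.
    sum-falling-vanish : ∀ {l} → l < n → ι (sumℕ (falling l) p) ≈ 0#
    sum-falling-vanish {l} l<n = ι-cancelˡ {suc l} (ℕ.s≤s ℕ.z≤n) (ℕ.s≤s l<n) (begin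
      ι (suc l) * ι (sumℕ (falling l) p)   ≈⟨ ι-* (suc l) (sumℕ (falling l) p) ⟨
      ι (suc l ℕ.* sumℕ (falling l) p)     ≡⟨ ≡.cong ι (≡.trans (sum-falling l p) (ℕₚ.*-comm p (falling l n))) ⟩
      ι (falling l n ℕ.* p)                ≈⟨ ι-*p (falling l n) ⟩
      0#                                   ≈⟨ zeroʳ _ ⟨
      ι (suc l) * 0#                       ∎)

    -- Sums over i ∈ 𝔽_p of Π_{k<m} (i + y_k), weighted by (i)_l so that a factor
    -- i + y can be absorbed through (i + y) (i)_l = (l + y) (i)_l + (i)_{l+1}.
    module _ (y : ℕ → Carrier) where

      weighted : ℕ → ℕ → Carrier
      weighted m l = sumF (λ i → prodF (λ k → ι i + y k) m * ι (falling l i)) p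

      weighted-zero : ∀ l → weighted 0 l ≈ ι (sumℕ (falling l) p)
      weighted-zero l = trans (sumF-cong p (λ _ → *-identityˡ _)) (sym (ι-sum (falling l) p))

      weighted-suc : ∀ m l → weighted (suc m) l ≈ (ι l + y m) * weighted m l + weighted m (suc l)
      weighted-suc m l = begin
        weighted (suc m) l
          ≈⟨ sumF-cong p (λ {i} _ → absorb i) ⟩
        sumF (λ i → (ι l + y m) * (prodF (λ k → ι i + y k) m * ι (falling l i)) + prodF (λ k → ι i + y k) m * ι (falling (suc l) i)) p
          ≈⟨ sumF-+ _ _ p ⟩
        sumF (λ i → (ι l + y m) * (prodF (λ k → ι i + y k) m * ι (falling l i))) p + weighted m (suc l)
          ≈⟨ +-congʳ (*-distribˡ-sumF (ι l + y m) _ p) ⟨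
        (ι l + y m) * weighted m l + weighted m (suc l) ∎
        where
        ι-falling : ∀ i → ι i * ι (falling l i) ≈ ι l * ι (falling l i) + ι (falling (suc l) i)
        ι-falling i = begin
          ι i * ι (falling l i)                               ≈⟨ ι-* i _ ⟨
          ι (i ℕ.* falling l i)                               ≡⟨ ≡.cong ι (*-falling l i) ⟩
          ι (l ℕ.* falling l i ℕ.+ falling (suc l) i)         ≈⟨ ι-+ (l ℕ.* falling l i) _ ⟩
          ι (l ℕ.* falling l i) + ι (falling (suc l) i)       ≈⟨ +-congʳ (ι-* l _) ⟩
          ι l * ι (falling l i) + ι (falling (suc l) i)       ∎
        absorb : ∀ i → let P = prodF (λ k → ι i + y k) m in
          P * (ι i + y m) * ι (falling l i) ≈ (ι l + y m) * (P * ι (falling l i)) + P * ι (falling (suc l) i)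
        absorb i = begin
          P * (ι i + y m) * f                   ≈⟨ solve 4 (λ P i y f → P :* (i :+ y) :* f := P :* (i :* f) :+ y :* (P :* f)) refl P (ι i) (y m) f ⟩
          P * (ι i * f) + y m * (P * f)         ≈⟨ +-congʳ (*-congˡ (ι-falling i)) ⟩
          P * (ι l * f + g) + y m * (P * f)     ≈⟨ solve 5 (λ P l y f g → P :* (l :* f :+ g) :+ y :* (P :* f) := (l :+ y) :* (P :* f) :+ P :* g) refl P (ι l) (y m) f g ⟩
          (ι l + y m) * (P * f) + P * g         ∎
          where
          P = prodF (λ k → ι i + y k) m
          f = ι (falling l i)
          g = ι (falling (suc l) i)

      -- m + l is the degree of the summand in i. Absorbing a factor gives one term of smaller
      -- degree and one with (i)_{l+1} in place of the factor, until bare falling factorials remain.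
      weighted-vanish : ∀ m l → m ℕ.+ l < n → weighted m l ≈ 0#
      weighted-vanish zero    l l<n = trans (weighted-zero l) (sum-falling-vanish l<n)
      weighted-vanish (suc m) l m+l<n = begin
        weighted (suc m) l                                 ≈⟨ weighted-suc m l ⟩
        (ι l + y m) * weighted m l + weighted m (suc l)    ≈⟨ +-cong (*-congˡ (weighted-vanish m l (<-trans (n<1+n _) m+l<n))) (weighted-vanish m (suc l) (≡.subst (_< n) (≡.sym (ℕₚ.+-suc m l)) m+l<n)) ⟩
        (ι l + y m) * 0# + 0#                              ≈⟨ trans (+-identityʳ _) (zeroʳ _) ⟩
        0#                                                 ∎

      -- In degree p - 1 the lower-degree term drops out, and every y_k with it: only the leading
      -- coefficient counts.
      weighted-top : ∀ m l → m ℕ.+ l ≡ n → weighted m l ≈ ι (sumℕ (falling n) p)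
      weighted-top zero    l ≡.refl = weighted-zero l
      weighted-top (suc m) l m+l≡n = begin
        weighted (suc m) l                                 ≈⟨ weighted-suc m l ⟩
        (ι l + y m) * weighted m l + weighted m (suc l)    ≈⟨ +-cong (*-congˡ (weighted-vanish m l (≡.subst (m ℕ.+ l <_) m+l≡n (n<1+n _)))) (weighted-top m (suc l) (≡.trans (ℕₚ.+-suc m l) m+l≡n)) ⟩
        (ι l + y m) * 0# + ι (sumℕ (falling n) p)          ≈⟨ trans (+-congʳ (zeroʳ _)) (+-identityˡ _) ⟩
        ι (sumℕ (falling n) p)                             ∎

      sum-prod≈weighted : ∀ m → sumF (λ i → prodF (λ k → ι i + y k) m) p ≈ weighted m 0
      sum-prod≈weighted m = sumF-cong p (λ _ → sym (trans (*-congˡ ι-1) (*-identityʳ _)))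

      sum-prod-vanish : ∀ m → m < n → sumF (λ i → prodF (λ k → ι i + y k) m) p ≈ 0#
      sum-prod-vanish m m<n = trans (sum-prod≈weighted m)
        (weighted-vanish m 0 (≡.subst (_< n) (≡.sym (ℕₚ.+-identityʳ m)) m<n))

      sum-prod≈ι : sumF (λ i → prodF (λ k → ι i + y k) n) p ≈ ι (sumℕ (falling n) p)
      sum-prod≈ι = trans (sum-prod≈weighted n) (weighted-top n 0 (ℕₚ.+-identityʳ n))

    pow≈prodF : ∀ x m → pow x m ≈ prodF (λ _ → x) m
    pow≈prodF x zero    = refl
    pow≈prodF x (suc m) = trans (*-comm _ _) (*-congʳ (pow≈prodF x m))

    -- The value does not depend on y, and y = 0 gives Σ_i i^{p-1} = p - 1.
    sum-prod-top : ∀ y → sumF (λ i → prodF (λ k → ι i + y k) n) p ≈ - 1#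
    sum-prod-top y = begin
      sumF (λ i → prodF (λ k → ι i + y k) n) p     ≈⟨ trans (sum-prod≈ι y) (sym (sum-prod≈ι (λ _ → 0#))) ⟩
      sumF (λ i → prodF (λ k → ι i + 0#) n) p      ≈⟨ sumF-cong p (λ {i} _ → trans (prodF-cong n (λ _ → +-identityʳ (ι i))) (sym (pow≈prodF (ι i) n))) ⟩
      sumF (λ i → pow (ι i) n) p                   ≈⟨ sumF-head _ n ⟩
      pow 0# n + sumF (λ i → pow (ι (suc i)) n) n  ≈⟨ +-cong (pow-0# n 0<n) (sumF-cong n (λ i<n → fermat (ℕ.s≤s ℕ.z≤n) (ℕ.s≤s i<n))) ⟩
      0# + sumF (λ _ → 1#) n                       ≈⟨ trans (+-identityˡ _) (trans (sumF-const 1# n) (*-identityʳ _)) ⟩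
      ι n                                          ≈⟨ +-cancelˡ 1# _ _ (trans char (sym (-‿inverseʳ 1#))) ⟩
      - 1#                                         ∎
      where
      -- p ≥ 2, so the term i = 0 contributes 0^(p-1) = 0 and not 1.
      0<n : 0 < n
      0<n = ℕₚ.n≢0⇒n>0 (λ n≡0 → contradiction (≡.subst (Prime ∘ suc) n≡0 pr) ¬prime[1])
      pow-0# : ∀ m → 0 < m → pow 0# m ≈ 0#
      pow-0# (suc m) _ = zeroˡ _

  -- Integer powers of a unit

  module IntegerPowers (θ θinv : Carrier) (inverse : θ * θinv ≈ 1#) where
    pow-inverse : ∀ k → pow θ k * pow θinv k ≈ 1#
    pow-inverse k = trans (sym (pow-distrib-* θ θinv k)) (trans (pow-cong k inverse) (pow-1# k))

    infix 9 θ^_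
    θ^_ : ℤ → Carrier
    θ^ i = powℤ θ θinv i

    θ^-cong : ∀ {i j} → i ≡ j → θ^ i ≈ θ^ j
    θ^-cong i≡j = reflexive (≡.cong θ^_ i≡j)

    -- Both mixed-sign cases of `θ^-+` reduce to this; each common successor costs one cancellation
    -- of θ against its inverse.
    θ^-⊖ : ∀ k l → θ^ (k ℤ.⊖ l) ≈ pow θ k * pow θinv l
    θ^-⊖ zero    zero    = sym (*-identityʳ _)
    θ^-⊖ (suc k) zero    = sym (*-identityʳ _)
    θ^-⊖ zero    (suc l) = sym (*-identityˡ _)
    θ^-⊖ (suc k) (suc l) = begin
      θ^ (suc k ℤ.⊖ suc l)                     ≈⟨ θ^-cong ([1+m]⊖[1+n]≡m⊖n k l) ⟩
      θ^ (k ℤ.⊖ l)                             ≈⟨ θ^-⊖ k l ⟩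
      pow θ k * pow θinv l                     ≈⟨ *-identityˡ _ ⟨
      1# * (pow θ k * pow θinv l)              ≈⟨ *-congʳ inverse ⟨
      θ * θinv * (pow θ k * pow θinv l)        ≈⟨ solve 4 (λ a b c d → a :* b :* (c :* d) := a :* c :* (b :* d)) refl θ θinv (pow θ k) (pow θinv l) ⟩
      θ * pow θ k * (θinv * pow θinv l)        ∎

    θ^-+ : ∀ i j → θ^ (i ℤ.+ j) ≈ θ^ i * θ^ j
    θ^-+ (+ k)    (+ l)    = pow-+ θ k l
    θ^-+ (+ k)    -[1+ l ] = θ^-⊖ k (suc l)
    θ^-+ -[1+ k ] (+ l)    = trans (θ^-⊖ l (suc k)) (*-comm _ _)
    θ^-+ -[1+ k ] -[1+ l ] = trans
      (*-congˡ (*-congˡ (pow-+ θinv k l)))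
      (solve 3 (λ t a b → t :* (t :* (a :* b)) := t :* a :* (t :* b)) refl θinv (pow θinv k) (pow θinv l))

    -- These integers form an ideal. Computing modulo it stands in for ℤ/k_p and also admits
    -- relations known only through θ itself.
    Annihilates : ℤ → Set ℓ
    Annihilates i = θ^ i ≈ 1#

    annihilates-+ : ∀ i j → Annihilates i → Annihilates j → Annihilates (i ℤ.+ j)
    annihilates-+ i j θⁱ θʲ = trans (θ^-+ i j) (trans (*-cong θⁱ θʲ) (*-identityˡ 1#))

    annihilates-neg : ∀ i → Annihilates i → Annihilates (ℤ.- i)
    annihilates-neg i θⁱ = begin
      θ^ (ℤ.- i)              ≈⟨ *-identityˡ _ ⟨
      1# * θ^ (ℤ.- i)         ≈⟨ *-congʳ θⁱ ⟨
      θ^ i * θ^ (ℤ.- i)       ≈⟨ θ^-+ i (ℤ.- i) ⟨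
      θ^ (i ℤ.- i)            ≈⟨ θ^-cong (ℤₚ.+-inverseʳ i) ⟩
      1#                      ∎

    annihilates-ℕ* : ∀ k i → Annihilates i → Annihilates (+ k ℤ.* i)
    annihilates-ℕ* zero    i θⁱ = refl
    annihilates-ℕ* (suc k) i θⁱ = trans (θ^-cong (ℤₚ.suc-* (+ k) i))
      (annihilates-+ i (+ k ℤ.* i) θⁱ (annihilates-ℕ* k i θⁱ))

    annihilates-* : ∀ j i → Annihilates i → Annihilates (j ℤ.* i)
    annihilates-* (+ k)    i θⁱ = annihilates-ℕ* k i θⁱ
    annihilates-* -[1+ k ] i θⁱ = trans (θ^-cong (≡.sym (ℤₚ.neg-distribˡ-* (+ suc k) i)))
      (annihilates-neg (+ suc k ℤ.* i) (annihilates-ℕ* (suc k) i θⁱ))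

    annihilates-∣ : ∀ {i j} → Annihilates i → i ∣ j → Annihilates j
    annihilates-∣ {i} {j} θⁱ i∣j with ∣ᵤ⇒∣ {i} {j} i∣j
    ... | divides q eq = trans (θ^-cong eq) (annihilates-* q i θⁱ)

  -- Throughout, R a m = θ (θ + a) ⋯ (θ + (m-1) a).
  module ArtinSchreier {n : ℕ} (pr : Prime (suc n)) (char : ι (suc n) ≈ 0#) (θ θinv : Carrier)
                       (artin-schreier : pow θ (suc n) ≈ θ + 1#) (inverse : θ * θinv ≈ 1#) where
    open Characteristic pr char
    open IntegerPowers θ θinv inverse

    private
      p = suc n

    -- The Artin-Schreier element: conjugates, trace of 1/θ, norm

    cancel-θ : ∀ {x y} → θ * x ≈ θ * y → x ≈ y
    cancel-θ = *-cancelˡ-invertible inverse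

    φ-θ : ∀ i → φ i θ ≈ θ + ι i
    φ-θ zero    = trans (φ-zero θ) (sym (+-identityʳ θ))
    φ-θ (suc i) = begin
      φ (suc i) θ              ≈⟨ φ-suc i θ ⟩
      φ i (φ 1 θ)              ≈⟨ φ-cong i (trans (φ-one θ) artin-schreier) ⟩
      φ i (θ + 1#)             ≈⟨ φ-+ i θ 1# ⟩
      φ i θ + φ i 1#           ≈⟨ +-cong (φ-θ i) (φ-1# i) ⟩
      θ + ι i + 1#             ≈⟨ solve 2 (λ t i → t :+ i :+ con 1 := t :+ (con 1 :+ i)) refl θ (ι i) ⟩
      θ + ι (suc i)            ∎

    φ-θ-*p : ∀ k → φ (k ℕ.* p) θ ≈ θ
    φ-θ-*p k = trans (φ-θ (k ℕ.* p)) (trans (+-congˡ (ι-*p k)) (+-identityʳ θ))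

    Fixed-θ : Fixed θ
    Fixed-θ = trans (φ-θ p) (trans (+-congˡ char) (+-identityʳ θ))

    Fixed-θinv : Fixed θinv
    Fixed-θinv = φ-fixes-inverse p Fixed-θ inverse

    -- Since θ^(p-1) = 1 + 1/θ and Tr 1 = 0, this is the trace of θ^(p-1), a sum of products of p -
    -- 1 linear factors.
    Tr-θinv : Tr p θinv ≈ - 1#
    Tr-θinv = begin
      Tr p θinv                                    ≈⟨ +-identityˡ _ ⟨
      0# + Tr p θinv                               ≈⟨ +-congʳ Tr-1# ⟨
      Tr p 1# + Tr p θinv                          ≈⟨ Tr-+ 1# θinv ⟨
      Tr p (1# + θinv)                             ≈⟨ Tr-cong θⁿ ⟨
      Tr p (pow θ n)                               ≈⟨ sumF-cong p (λ {i} _ → trans (φ-pow i θ n) (pow-cong n (trans (φ-θ i) (+-comm θ (ι i))))) ⟩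
      sumF (λ i → pow (ι i + θ) n) p               ≈⟨ sumF-cong p (λ {i} _ → pow≈prodF (ι i + θ) n) ⟩
      sumF (λ i → prodF (λ _ → ι i + θ) n) p       ≈⟨ sum-prod-top (λ _ → θ) ⟩
      - 1#                                         ∎
      where
      θⁿ : pow θ n ≈ 1# + θinv
      θⁿ = cancel-θ (begin
        θ * pow θ n          ≈⟨ artin-schreier ⟩
        θ + 1#               ≈⟨ +-cong (*-identityʳ θ) inverse ⟨
        θ * 1# + θ * θinv    ≈⟨ distribˡ θ 1# θinv ⟨
        θ * (1# + θinv)      ∎)

    -- The factors θ + k a appear as conjugates of θ, on which `φ a` acts by shifting k.
    R : ℕ → ℕ → Carrier
    R a = prodF (λ k → φ (k ℕ.* a) θ)

    φ-R : ∀ a m → φ a (R a m) ≈ prodF (λ k → φ (suc k ℕ.* a) θ) m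
    φ-R a m = trans (φ-prodF a _ m) (prodF-cong m (λ k →
      trans (φ-φ a (k ℕ.* a) θ) (reflexive (≡.cong (λ i → φ i θ) (ℕₚ.+-comm (k ℕ.* a) a)))))

    R-head : ∀ a m → R a (suc m) ≈ θ * φ a (R a m)
    R-head a m = trans (prodF-head _ m) (*-cong (φ-zero θ) (sym (φ-R a m)))

    Fixed-R : ∀ a m → Fixed (R a m)
    Fixed-R a m = Fixed-prodF (λ k → Fixed-φ Fixed-θ (k ℕ.* a)) m

    -- `φ i` adds i to each factor, which gives the shape Σ_i Π_k (i + y_k) with y_k = θ + (k+1) a.
    Tr-φ-R : ∀ a m → Tr p (φ a (R a m)) ≈ sumF (λ i → prodF (λ k → ι i + (θ + ι (suc k ℕ.* a))) m) p
    Tr-φ-R a m = sumF-cong p (λ {i} _ → trans (φ-cong i (φ-R a m))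
      (trans (φ-prodF i _ m) (prodF-cong m (λ k → conjugate i (suc k ℕ.* a)))))
      where
      conjugate : ∀ i j → φ i (φ j θ) ≈ ι i + (θ + ι j)
      conjugate i j = begin
        φ i (φ j θ)            ≈⟨ φ-cong i (φ-θ j) ⟩
        φ i (θ + ι j)          ≈⟨ φ-+ i θ (ι j) ⟩
        φ i θ + φ i (ι j)      ≈⟨ +-cong (φ-θ i) (φ-ι i j) ⟩
        θ + ι i + ι j          ≈⟨ solve 3 (λ t i j → t :+ i :+ j := i :+ (t :+ j)) refl θ (ι i) (ι j) ⟩
        ι i + (θ + ι j)        ∎

    Tr-φ-R-vanish : ∀ a {m} → m < n → Tr p (φ a (R a m)) ≈ 0#
    Tr-φ-R-vanish a {m} m<n = trans (Tr-φ-R a m) (sum-prod-vanish _ m m<n)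

    -- R a p is a scalar, so it can be read off from Tr (R a p / θ).
    R-p : ∀ {a} → gcd a p ≡ 1 → R a p ≈ 1#
    R-p {a} a⊥p = -‿injective (begin
      - R a p                    ≈⟨ -‿cong (*-identityʳ _) ⟨
      - (R a p * 1#)             ≈⟨ -‿distribʳ-* _ _ ⟩
      R a p * - 1#               ≈⟨ *-congˡ Tr-θinv ⟨
      R a p * Tr p θinv          ≈⟨ Tr-*ˡ scalar θinv ⟨
      Tr p (R a p * θinv)        ≈⟨ Tr-cong quotient ⟩
      Tr p (φ a (R a n))         ≈⟨ trans (Tr-φ-R a n) (sum-prod-top _) ⟩
      - 1#                       ∎)
      where
      -- After multiplication by θ both sides are `R a (suc p)`, because its last factor θ + p a is
      -- θ again.
      invariant : φ a (R a p) ≈ R a p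
      invariant = cancel-θ (begin
        θ * φ a (R a p)          ≈⟨ R-head a p ⟨
        R a p * φ (p ℕ.* a) θ    ≈⟨ *-congˡ (trans (reflexive (≡.cong (λ k → φ k θ) (ℕₚ.*-comm p a))) (φ-θ-*p a)) ⟩
        R a p * θ                ≈⟨ *-comm _ _ ⟩
        θ * R a p                ∎)
      scalar : InPrimeField (R a p)
      scalar = φ-prime-field-generator (Fixed-R a p) {a} a⊥p invariant
      -- Cancelling the leading θ leaves p - 1 linear factors, exactly the degree in which the trace
      -- is -1.
      quotient : R a p * θinv ≈ φ a (R a n)
      quotient = begin
        R a p * θinv                  ≈⟨ *-congʳ (R-head a n) ⟩
        θ * φ a (R a n) * θinv        ≈⟨ solve 3 (λ t r i → t :* r :* i := t :* i :* r) refl θ _ θinv ⟩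
        θ * θinv * φ a (R a n)        ≈⟨ trans (*-congʳ inverse) (*-identityˡ _) ⟩
        φ a (R a n)                   ∎

    -- k_p = 1 + p + ... + p^(p-1) makes θ^(k_p) the norm of θ, the case a = 1 of `R-p`.
    annihilates-kp : Annihilates (+ kp p)
    annihilates-kp = begin
      pow θ (kp p)                       ≈⟨ pow-sumℕ θ (λ i → p ℕ.^ i) p ⟩
      prodF (λ i → φ i θ) p              ≈⟨ prodF-cong p (λ i → reflexive (≡.cong (λ k → φ k θ) (ℕₚ.*-identityʳ i))) ⟨
      R 1 p                              ≈⟨ R-p (coprime⇒gcd≡1 (1-coprimeTo p)) ⟩
      1#                                 ∎

    -- The elements β and γ, and the normalisation of their traces

    module Twist (a : ℕ) (a⊥p : gcd a p ≡ 1) where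

      β γ : Carrier
      β = pow θ (τ p a)
      γ = pow θinv (suc (τ p a))

      Fixed-β : Fixed β
      Fixed-β = Fixed-pow Fixed-θ (τ p a)

      Fixed-γ : Fixed γ
      Fixed-γ = Fixed-pow Fixed-θinv (suc (τ p a))

      0<a : 0 < a
      -- For a = 0 the gcd would be p, forcing p = 1.
      0<a = ℕₚ.n≢0⇒n>0 λ { ≡.refl → contradiction (≡.subst Prime a⊥p pr) ¬prime[1] }

      -- `τ-identity` read in the exponents of θ: the sum of the p^(ja-1) contributes U = 1, and
      -- p^(pa) contributes θ.
      φ-β : φ a β ≈ θ * β
      φ-β = begin
        φ a β                                          ≈⟨ *-identityʳ _ ⟨
        φ a β * 1#                                     ≈⟨ *-cong (pow-pow θ (τ p a) (p ℕ.^ a)) (sym U≈1) ⟩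
        pow θ (τ p a ℕ.* p ℕ.^ a) * U                  ≈⟨ *-congˡ (pow-sumℕ θ e p) ⟨
        pow θ (τ p a ℕ.* p ℕ.^ a) * pow θ (sumℕ e p)   ≈⟨ pow-+ θ (τ p a ℕ.* p ℕ.^ a) (sumℕ e p) ⟨
        pow θ (τ p a ℕ.* p ℕ.^ a ℕ.+ sumℕ e p)         ≡⟨ ≡.cong (pow θ) (τ-identity n 0<a) ⟩
        pow θ (τ p a ℕ.+ p ℕ.^ (p ℕ.* a))              ≈⟨ pow-+ θ (τ p a) _ ⟩
        β * φ (p ℕ.* a) θ                              ≈⟨ *-congˡ (trans (reflexive (≡.cong (λ k → φ k θ) (ℕₚ.*-comm p a))) (φ-θ-*p a)) ⟩
        β * θ                                          ≈⟨ *-comm β θ ⟩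
        θ * β                                          ∎
        where
        e : ℕ → ℕ
        e j = p ℕ.^ (suc j ℕ.* a ℕ.∸ 1)
        U : Carrier
        U = prodF (λ j → pow θ (e j)) p
        -- One Frobenius turns the exponents p^(ja-1) into p^(ja) for j = 1, ..., p, so U^p is a
        -- conjugate of `R a p`.
        φ₁-U : φ 1 U ≈ 1#
        φ₁-U = begin
          φ 1 U                                           ≈⟨ φ-prodF 1 _ p ⟩
          prodF (λ j → φ 1 (φ (suc j ℕ.* a ℕ.∸ 1) θ)) p   ≈⟨ prodF-cong p (λ j → trans (φ-φ 1 (suc j ℕ.* a ℕ.∸ 1) θ) (reflexive (≡.cong (λ k → φ k θ) (ℕₚ.m∸n+n≡m (ℕₚ.≤-trans 0<a (ℕₚ.m≤m+n a (j ℕ.* a))))))) ⟩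
          prodF (λ j → φ (suc j ℕ.* a) θ) p               ≈⟨ φ-R a p ⟨
          φ a (R a p)                                     ≈⟨ φ-cong a (R-p a⊥p) ⟩
          φ a 1#                                          ≈⟨ φ-1# a ⟩
          1#                                              ∎
        -- φ 1 is injective on the fixed points of φ p.
        U≈1 : U ≈ 1#
        U≈1 = begin
          U             ≈⟨ Fixed-prodF (λ j → Fixed-pow Fixed-θ (e j)) p ⟨
          φ p U         ≈⟨ φ-suc n U ⟩
          φ n (φ 1 U)   ≈⟨ trans (φ-cong n φ₁-U) (φ-1# n) ⟩
          1#            ∎

      βγ : β * γ ≈ θinv
      βγ = begin
        β * (θinv * pow θinv (τ p a))     ≈⟨ solve 3 (λ b i c → b :* (i :* c) := b :* c :* i) refl β θinv _ ⟩
        β * pow θinv (τ p a) * θinv       ≈⟨ trans (*-congʳ (pow-inverse (τ p a))) (*-identityˡ θinv) ⟩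
        θinv                              ∎

      θβγ : θ * β * γ ≈ 1#
      θβγ = trans (*-assoc θ β γ) (trans (*-congˡ βγ) inverse)

      φ-γ : φ a γ * φ a θ ≈ γ
      φ-γ = *-cancelˡ-invertible θβγ (begin
        θ * β * (φ a γ * φ a θ)         ≈⟨ *-congʳ φ-β ⟨
        φ a β * (φ a γ * φ a θ)         ≈⟨ solve 3 (λ b g t → b :* (g :* t) := t :* b :* g) refl (φ a β) (φ a γ) (φ a θ) ⟩
        φ a θ * φ a β * φ a γ           ≈⟨ trans (φ-* a (θ * β) γ) (*-congʳ (φ-* a θ β)) ⟨
        φ a (θ * β * γ)                 ≈⟨ trans (φ-cong a θβγ) (φ-1# a) ⟩
        1#                              ≈⟨ θβγ ⟨
        θ * β * γ                       ∎)

      φ-*-β : ∀ k → φ (k ℕ.* a) β ≈ R a k * β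
      φ-*-β zero    = trans (φ-zero β) (sym (*-identityˡ β))
      φ-*-β (suc k) = begin
        φ (a ℕ.+ k ℕ.* a) β                   ≈⟨ φ-φ (k ℕ.* a) a β ⟨
        φ (k ℕ.* a) (φ a β)                   ≈⟨ φ-cong (k ℕ.* a) φ-β ⟩
        φ (k ℕ.* a) (θ * β)                   ≈⟨ φ-* (k ℕ.* a) θ β ⟩
        φ (k ℕ.* a) θ * φ (k ℕ.* a) β         ≈⟨ *-congˡ (φ-*-β k) ⟩
        φ (k ℕ.* a) θ * (R a k * β)           ≈⟨ solve 3 (λ t r b → t :* (r :* b) := r :* t :* b) refl _ (R a k) β ⟩
        R a (suc k) * β                       ∎

      -- As β γ = 1/θ, the j-th conjugate of β contributes `R a j` / θ. For j = 0 this is 1/θ;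
      -- otherwise the leading θ cancels and j - 1 ≤ p - 2 factors remain, too few for a nonzero
      -- trace.
      Tr-β*γ : Tr p β * γ ≈ θinv + sumF (λ j → φ a (R a j)) n
      Tr-β*γ = begin
        Tr p β * γ                                       ≈⟨ *-congʳ (Tr-scale Fixed-β a⊥p) ⟨
        sumF (λ j → φ (j ℕ.* a) β) p * γ                 ≈⟨ *-distribʳ-sumF γ _ p ⟩
        sumF (λ j → φ (j ℕ.* a) β * γ) p                 ≈⟨ sumF-cong p (λ {j} _ → trans (*-congʳ (φ-*-β j)) (trans (*-assoc _ β γ) (*-congˡ βγ))) ⟩
        sumF (λ j → R a j * θinv) p                      ≈⟨ sumF-head _ n ⟩
        1# * θinv + sumF (λ j → R a (suc j) * θinv) n    ≈⟨ +-cong (*-identityˡ θinv) (sumF-cong n (λ {j} _ → quotient j)) ⟩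
        θinv + sumF (λ j → φ a (R a j)) n                ∎
        where
        quotient : ∀ j → R a (suc j) * θinv ≈ φ a (R a j)
        quotient j = begin
          R a (suc j) * θinv            ≈⟨ *-congʳ (R-head a j) ⟩
          θ * φ a (R a j) * θinv        ≈⟨ solve 3 (λ t r i → t :* r :* i := t :* i :* r) refl θ _ θinv ⟩
          θ * θinv * φ a (R a j)        ≈⟨ trans (*-congʳ inverse) (*-identityˡ _) ⟩
          φ a (R a j)                   ∎

      Tr-β*Tr-γ : Tr p β * Tr p γ ≈ - 1#
      Tr-β*Tr-γ = begin
        Tr p β * Tr p γ                                  ≈⟨ Tr-*ˡ (Tr-prime-field Fixed-β) γ ⟨
        Tr p (Tr p β * γ)                                ≈⟨ Tr-cong Tr-β*γ ⟩
        Tr p (θinv + sumF (λ j → φ a (R a j)) n)         ≈⟨ Tr-+ θinv _ ⟩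
        Tr p θinv + Tr p (sumF (λ j → φ a (R a j)) n)    ≈⟨ +-cong Tr-θinv (trans (Tr-sumF _ n) (sumF-zero n (Tr-φ-R-vanish a))) ⟩
        - 1# + 0#                                        ≈⟨ +-identityʳ _ ⟩
        - 1#                                             ∎

      -- ι (k (p-1) a) stands for -k a, so that Q j = θ (θ - a) ⋯ (θ - (j-1) a).
      z : ℕ → Carrier
      z k = ι (k ℕ.* (n ℕ.* a))

      Q : ℕ → Carrier
      Q = prodF (λ k → θ + z k)

      z+ : ∀ k → ι k * ι a + z k ≈ 0#
      z+ k = begin
        ι k * ι a + z k                     ≈⟨ +-congʳ (ι-* k a) ⟨
        ι (k ℕ.* a) + z k                   ≈⟨ ι-+ (k ℕ.* a) _ ⟨
        ι (k ℕ.* a ℕ.+ k ℕ.* (n ℕ.* a))     ≡⟨ ≡.cong ι (lemma k a n) ⟩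
        ι (k ℕ.* a ℕ.* p)                   ≈⟨ ι-*p (k ℕ.* a) ⟩
        0#                                  ∎
        where
        open import Data.Nat.Tactic.RingSolver using (solve-∀)
        lemma : ∀ k a n → k ℕ.* a ℕ.+ k ℕ.* (n ℕ.* a) ≡ k ℕ.* a ℕ.* suc n
        lemma = solve-∀

      φ-θ+z : ∀ k → φ a (θ + z (suc k)) ≈ θ + z k
      φ-θ+z k = begin
        φ a (θ + z (suc k))              ≈⟨ φ-+ a θ _ ⟩
        φ a θ + φ a (z (suc k))          ≈⟨ +-cong (φ-θ a) (trans (φ-ι a (suc k ℕ.* (n ℕ.* a))) (ι-+ (n ℕ.* a) _)) ⟩
        θ + ι a + (ι (n ℕ.* a) + z k)    ≈⟨ solve 4 (λ t x y z → t :+ x :+ (y :+ z) := t :+ (x :+ y :+ z)) refl θ (ι a) _ (z k) ⟩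
        θ + (ι a + ι (n ℕ.* a) + z k)    ≈⟨ +-congˡ (+-congʳ (trans (sym (ι-+ a (n ℕ.* a))) (trans (reflexive (≡.cong ι (ℕₚ.*-comm p a))) (ι-*p a)))) ⟩
        θ + (0# + z k)                   ≈⟨ +-congˡ (+-identityˡ _) ⟩
        θ + z k                          ∎

      -- Each factor θ - (k+1) a moves to θ - k a, while the first factor θ becomes θ + a and is
      -- absorbed by γ.
      φ-γQ : ∀ j → φ a (γ * Q (suc j)) ≈ γ * Q j
      φ-γQ j = begin
        φ a (γ * Q (suc j))                                              ≈⟨ φ-* a γ _ ⟩
        φ a γ * φ a (Q (suc j))                                          ≈⟨ *-congˡ (trans (φ-prodF a _ (suc j)) (prodF-head _ j)) ⟩
        φ a γ * (φ a (θ + 0#) * prodF (λ k → φ a (θ + z (suc k))) j)     ≈⟨ *-congˡ (*-cong (φ-cong a (+-identityʳ θ)) (prodF-cong j φ-θ+z)) ⟩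
        φ a γ * (φ a θ * Q j)                                            ≈⟨ *-assoc _ _ _ ⟨
        φ a γ * φ a θ * Q j                                              ≈⟨ *-congʳ φ-γ ⟩
        γ * Q j                                                          ∎

      Fixed-γQ : ∀ j → Fixed (γ * Q j)
      Fixed-γQ j = Fixed-* Fixed-γ (Fixed-prodF (λ k → trans (φ-+ p θ (z k)) (+-cong Fixed-θ (φ-ι p (k ℕ.* (n ℕ.* a))))) j)

      Tr-γQ : ∀ j → Tr p (γ * Q j) ≈ Tr p γ
      Tr-γQ zero    = Tr-cong (*-identityʳ γ)
      Tr-γQ (suc j) = trans (sym (Tr-φ (Fixed-γQ (suc j)) a)) (trans (Tr-cong (φ-γQ j)) (Tr-γQ j))

      -- Stirling expansion of θ^m and the Bell polynomial

      module _ {ainv : Carrier} (a-inverse : ι a * ainv ≈ 1#) where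

        -- The coefficient a^(m-j) S(m,j), written without a truncated exponent; its sum over j is
        -- a^m b_m(1/a) at once.
        w : ℕ → ℕ → Carrier
        w m j = pow (ι a) m * (ι (S m j) * pow ainv j)

        w-vanish : ∀ {m j} → m < j → w m j ≈ 0#
        w-vanish {m} {j} m<j = trans
          (*-congˡ (trans (*-congʳ (reflexive (≡.cong ι (S-vanish m<j)))) (zeroˡ _))) (zeroʳ _)

        w-suc : ∀ m j → w (suc m) (suc j) ≈ ι (suc j) * ι a * w m (suc j) + w m j
        w-suc m j = begin
          (A * Aᵐ) * (ι (suc j ℕ.* S m (suc j) ℕ.+ S m j) * (V * Vʲ))
            ≈⟨ *-congˡ (*-congʳ (trans (ι-+ (suc j ℕ.* S m (suc j)) (S m j)) (+-congʳ (ι-* (suc j) (S m (suc j)))))) ⟩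
          (A * Aᵐ) * ((ι (suc j) * s + t) * (V * Vʲ))
            ≈⟨ solve 7 (λ A Aᵐ J s t V Vʲ →
                 (A :* Aᵐ) :* ((J :* s :+ t) :* (V :* Vʲ)) :=
                 J :* A :* (Aᵐ :* (s :* (V :* Vʲ))) :+ A :* V :* (Aᵐ :* (t :* Vʲ)))
               refl A Aᵐ (ι (suc j)) s t V Vʲ ⟩
          ι (suc j) * A * w m (suc j) + A * V * w m j
            ≈⟨ +-congˡ (trans (*-congʳ a-inverse) (*-identityˡ _)) ⟩
          ι (suc j) * A * w m (suc j) + w m j ∎
          where
          A = ι a
          Aᵐ = pow (ι a) m
          V = ainv
          Vʲ = pow ainv j
          s = ι (S m (suc j))
          t = ι (S m j)

        -- θ = (θ - j a) + j a gives θ Q_j = Q_{j+1} + j a Q_j, so the coefficients obey the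
        -- Stirling recurrence scaled by a.
        pow-θ-expansion : ∀ m → pow θ m ≈ sumF (λ j → w m j * Q j) (suc m)
        pow-θ-expansion zero    = sym (trans (+-identityˡ _) (trans (*-identityʳ _)
          (trans (*-identityˡ _) (trans (*-identityʳ _) ι-1))))
        pow-θ-expansion (suc m) = begin
          θ * pow θ m                                              ≈⟨ *-congˡ (pow-θ-expansion m) ⟩
          θ * sumF (λ j → w m j * Q j) (suc m)                     ≈⟨ *-distribˡ-sumF θ _ (suc m) ⟩
          sumF (λ j → θ * (w m j * Q j)) (suc m)                   ≈⟨ sumF-cong (suc m) (λ {j} _ → split j) ⟩
          sumF (λ j → g j + w m j * Q (suc j)) (suc m)             ≈⟨ sumF-+ g _ (suc m) ⟩
          sumF g (suc m) + h                                       ≈⟨ +-congʳ shift ⟨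
          sumF (g ∘ suc) (suc m) + h                               ≈⟨ sumF-+ (g ∘ suc) _ (suc m) ⟨
          sumF (λ j → g (suc j) + w m j * Q (suc j)) (suc m)       ≈⟨ sumF-cong (suc m) (λ {j} _ → merge j) ⟨
          sumF (λ j → w (suc m) (suc j) * Q (suc j)) (suc m)       ≈⟨ +-identityˡ _ ⟨
          0# + sumF (λ j → w (suc m) (suc j) * Q (suc j)) (suc m)  ≈⟨ +-congʳ head ⟨
          w (suc m) 0 * Q 0 + sumF (λ j → w (suc m) (suc j) * Q (suc j)) (suc m) ≈⟨ sumF-head (λ j → w (suc m) j * Q j) (suc m) ⟨
          sumF (λ j → w (suc m) j * Q j) (suc (suc m))             ∎
          where
          g : ℕ → Carrier
          g j = ι j * ι a * w m j * Q j
          h : Carrier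
          h = sumF (λ j → w m j * Q (suc j)) (suc m)
          split : ∀ j → θ * (w m j * Q j) ≈ g j + w m j * Q (suc j)
          split j = begin
            θ * (w m j * Q j)                            ≈⟨ *-congʳ (+-identityʳ θ) ⟨
            (θ + 0#) * (w m j * Q j)                     ≈⟨ *-congʳ (+-congˡ (z+ j)) ⟨
            (θ + (ι j * ι a + z j)) * (w m j * Q j)      ≈⟨ solve 5 (λ t x z w q → (t :+ (x :+ z)) :* (w :* q) := x :* w :* q :+ w :* (q :* (t :+ z))) refl θ (ι j * ι a) (z j) (w m j) (Q j) ⟩
            g j + w m j * Q (suc j)                      ∎
          merge : ∀ j → w (suc m) (suc j) * Q (suc j) ≈ g (suc j) + w m j * Q (suc j)
          merge j = trans (*-congʳ (w-suc m j)) (distribʳ _ _ _)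
          head : w (suc m) 0 * Q 0 ≈ 0#
          head = trans (*-identityʳ _) (trans (*-congˡ (zeroˡ _)) (zeroʳ _))
          -- Both end terms vanish: `g 0` through its factor j = 0, `g (suc m)` because S(m, m+1) =
          -- 0.
          shift : sumF (g ∘ suc) (suc m) ≈ sumF g (suc m)
          shift = begin
            sumF (g ∘ suc) (suc m)           ≈⟨ +-identityˡ _ ⟨
            0# + sumF (g ∘ suc) (suc m)      ≈⟨ +-congʳ (trans (*-congʳ (trans (*-congʳ (zeroˡ _)) (zeroˡ _))) (zeroˡ _)) ⟨
            g 0 + sumF (g ∘ suc) (suc m)     ≈⟨ sumF-head g (suc m) ⟨
            sumF g (suc m) + g (suc m)       ≈⟨ +-congˡ (trans (*-congʳ (trans (*-congˡ (w-vanish (n<1+n m))) (zeroʳ _))) (zeroˡ _)) ⟩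
            sumF g (suc m) + 0#              ≈⟨ +-identityʳ _ ⟩
            sumF g (suc m)                   ∎

        InPrimeField-w : ∀ m j → InPrimeField (w m j)
        InPrimeField-w m j = InPrimeField-* (InPrimeField-pow (φ-ι 1 a) m)
          (InPrimeField-* (φ-ι 1 (S m j)) (InPrimeField-pow (φ-fixes-inverse 1 (φ-ι 1 a) a-inverse) j))

        Tr-γ-pow : ∀ m → Tr p (γ * pow θ m) ≈ pow (ι a) m * bell m ainv * Tr p γ
        Tr-γ-pow m = begin
          Tr p (γ * pow θ m)                                  ≈⟨ Tr-cong (trans (*-congˡ (pow-θ-expansion m)) (*-distribˡ-sumF γ _ (suc m))) ⟩
          Tr p (sumF (λ j → γ * (w m j * Q j)) (suc m))       ≈⟨ Tr-sumF _ (suc m) ⟩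
          sumF (λ j → Tr p (γ * (w m j * Q j))) (suc m)       ≈⟨ sumF-cong (suc m) (λ {j} _ → term j) ⟩
          sumF (λ j → w m j * Tr p γ) (suc m)                 ≈⟨ *-distribʳ-sumF (Tr p γ) _ (suc m) ⟨
          sumF (w m) (suc m) * Tr p γ                         ≈⟨ *-congʳ (*-distribˡ-sumF _ _ (suc m)) ⟨
          pow (ι a) m * bell m ainv * Tr p γ                  ∎
          where
          term : ∀ j → Tr p (γ * (w m j * Q j)) ≈ w m j * Tr p γ
          term j = begin
            Tr p (γ * (w m j * Q j))        ≈⟨ Tr-cong (solve 3 (λ g w q → g :* (w :* q) := w :* (g :* q)) refl γ (w m j) (Q j)) ⟩
            Tr p (w m j * (γ * Q j))        ≈⟨ Tr-*ˡ (InPrimeField-w m j) _ ⟩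
            w m j * Tr p (γ * Q j)          ≈⟨ *-congˡ (Tr-γQ j) ⟩
            w m j * Tr p γ                  ∎

        -- Multiplying `Tr-γ-pow` by Tr β replaces the unknown Tr γ by Tr β Tr γ = -1.
        bell-trace : ∀ m → pow (ι a) m * bell m ainv ≈ - (Tr p β * Tr p (γ * pow θ m))
        bell-trace m = sym (begin
          - (Tr p β * Tr p (γ * pow θ m))      ≈⟨ -‿cong (*-congˡ (Tr-γ-pow m)) ⟩
          - (Tr p β * (B * Tr p γ))            ≈⟨ -‿cong (solve 3 (λ b w g → b :* (w :* g) := w :* (b :* g)) refl _ B _) ⟩
          - (B * (Tr p β * Tr p γ))            ≈⟨ -‿cong (*-congˡ Tr-β*Tr-γ) ⟩
          - (B * - 1#)                         ≈⟨ -‿cong (-‿distribʳ-* B 1#) ⟨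
          - - (B * 1#)                         ≈⟨ trans (-‿involutive _) (*-identityʳ B) ⟩
          B                                    ∎)
          where B = pow (ι a) m * bell m ainv

        -- At m = τ the second trace is that of γ β = 1/θ, again -1.
        bell-trace-τ : Tr p β ≈ pow (ι a) (τ p a) * bell (τ p a) ainv
        bell-trace-τ = sym (begin
          pow (ι a) (τ p a) * bell (τ p a) ainv    ≈⟨ bell-trace (τ p a) ⟩
          - (Tr p β * Tr p (γ * β))                ≈⟨ -‿cong (*-congˡ (trans (Tr-cong (trans (*-comm γ β) βγ)) Tr-θinv)) ⟩
          - (Tr p β * - 1#)                        ≈⟨ -‿cong (-‿distribʳ-* _ 1#) ⟨
          - - (Tr p β * 1#)                        ≈⟨ trans (-‿involutive _) (*-identityʳ _) ⟩
          Tr p β                                   ∎)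

      -- Integer exponents and θ^ζ

      θ^-shift : ∀ m → θ^ (+ m ℤ.- + 1 ℤ.- + τ p a) ≈ γ * pow θ m
      θ^-shift m = begin
        θ^ (+ m ℤ.- + 1 ℤ.- + τ p a)      ≈⟨ θ^-cong (≡.trans (ℤₚ.+-assoc (+ m) (ℤ.- + 1) (ℤ.- + τ p a)) (≡.trans (≡.cong (λ i → + m ℤ.+ i) (≡.sym (ℤₚ.neg-distrib-+ (+ 1) (+ τ p a)))) (ℤₚ.[+m]-[+n]≡m⊖n m (suc (τ p a))))) ⟩
        θ^ (m ℤ.⊖ suc (τ p a))            ≈⟨ θ^-⊖ m (suc (τ p a)) ⟩
        pow θ m * γ                       ≈⟨ *-comm _ _ ⟩
        γ * pow θ m                       ∎

      pos-^ : ∀ m k → (+ m) ℤ.^ k ≡ + (m ℕ.^ k)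
      pos-^ m zero    = ≡.refl
      pos-^ m (suc k) = ≡.trans (≡.cong ((+ m) ℤ.*_) (pos-^ m k)) (≡.sym (ℤₚ.pos-* m (m ℕ.^ k)))

      -- P represents p^(-a) and Z represents ζ modulo k_p; the conclusion is ζ = p^a τ in the
      -- exponents of θ.
      θ^-ζ : ∀ (P Z : ℤ) → + kp p ∣ (P ℤ.* ((+ p) ℤ.^ a) ℤ.- + 1) →
             + kp p ∣ (Z ℤ.* (+ 1 ℤ.- P) ℤ.- + 1) → θ^ Z ≈ φ a β
      θ^-ζ P Z kp∣P kp∣Z = begin
        θ^ Z                            ≈⟨ θ^-cong (lemma T q P Z) ⟩
        θ^ (T ℤ.* q ℤ.+ e)              ≈⟨ θ^-+ (T ℤ.* q) e ⟩
        θ^ (T ℤ.* q) * θ^ e             ≈⟨ *-cong θ^Tq annihilates-e ⟩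
        φ a β * 1#                      ≈⟨ *-identityʳ _ ⟩
        φ a β                           ∎
        where
        open import Data.Integer.Tactic.RingSolver using (solve-∀)
        T = + τ p a
        q = (+ p) ℤ.^ a
        e₁ = T ℤ.* q ℤ.- T ℤ.- + 1
        e₂ = Z ℤ.* (+ 1 ℤ.- P) ℤ.- + 1
        e₃ = P ℤ.* q ℤ.- + 1
        -- Certificate for Z = τ q + e: the relations τ q = τ + 1, Z (1 - P) = 1 and P q = 1 are
        -- combined so that q - 1 is never inverted. The first comes from `φ-β`, the other two from
        -- divisibility by k_p.
        e = ℤ.- Z ℤ.* e₁ ℤ.+ T ℤ.* (q ℤ.* e₂ ℤ.+ Z ℤ.* e₃)
        lemma : ∀ T q P Z → Z ≡ T ℤ.* q ℤ.+ (ℤ.- Z ℤ.* (T ℤ.* q ℤ.- T ℤ.- + 1) ℤ.+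
          T ℤ.* (q ℤ.* (Z ℤ.* (+ 1 ℤ.- P) ℤ.- + 1) ℤ.+ Z ℤ.* (P ℤ.* q ℤ.- + 1)))
        lemma = solve-∀
        θ^Tq : θ^ (T ℤ.* q) ≈ φ a β
        θ^Tq = begin
          θ^ (T ℤ.* q)                     ≈⟨ θ^-cong (≡.trans (≡.cong (T ℤ.*_) (pos-^ p a)) (≡.sym (ℤₚ.pos-* (τ p a) (p ℕ.^ a)))) ⟩
          pow θ (τ p a ℕ.* p ℕ.^ a)        ≈⟨ pow-pow θ (τ p a) (p ℕ.^ a) ⟨
          φ a β                            ∎
        annihilates-e₁ : Annihilates e₁
        annihilates-e₁ = begin
          θ^ (T ℤ.* q ℤ.- T ℤ.- + 1)                          ≈⟨ θ^-+ (T ℤ.* q ℤ.- T) (ℤ.- + 1) ⟩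
          θ^ (T ℤ.* q ℤ.- T) * θ^ (ℤ.- + 1)                   ≈⟨ *-cong (θ^-+ (T ℤ.* q) (ℤ.- T)) (*-identityʳ θinv) ⟩
          θ^ (T ℤ.* q) * θ^ (ℤ.- T) * θinv                    ≈⟨ *-congʳ (*-congʳ (trans θ^Tq φ-β)) ⟩
          θ * β * θ^ (ℤ.- T) * θinv                           ≈⟨ solve 4 (λ t b c i → t :* b :* c :* i := t :* i :* (b :* c)) refl θ β _ θinv ⟩
          θ * θinv * (θ^ T * θ^ (ℤ.- T))                      ≈⟨ *-cong inverse (trans (sym (θ^-+ T (ℤ.- T))) (θ^-cong (ℤₚ.+-inverseʳ T))) ⟩
          1# * 1#                                             ≈⟨ *-identityˡ 1# ⟩
          1#                                                  ∎
        annihilates-e : Annihilates e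
        annihilates-e = annihilates-+ (ℤ.- Z ℤ.* e₁) (T ℤ.* (q ℤ.* e₂ ℤ.+ Z ℤ.* e₃))
          (annihilates-* (ℤ.- Z) e₁ annihilates-e₁)
          (annihilates-* T (q ℤ.* e₂ ℤ.+ Z ℤ.* e₃)
            (annihilates-+ (q ℤ.* e₂) (Z ℤ.* e₃)
              (annihilates-* q e₂ (annihilates-∣ {+ kp p} {e₂} annihilates-kp kp∣Z))
              (annihilates-* Z e₃ (annihilates-∣ {+ kp p} {e₃} annihilates-kp kp∣P))))

open import Data.Product using (_×_; _,_)

theorem1p2 : {c ℓ : Level} (F : CommutativeRing c ℓ) →
  let open CommutativeRing F
      open InRing F
  in (p : ℕ) → Prime p → IsField → HasCard (p ℕ.^ p) →
     (θ θinv : Carrier) → pow θ p ≈ θ + 1# → θ * θinv ≈ 1# →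
     (a m : ℕ) → gcd a p ≡ 1 →
     (ainv : Carrier) → ι a * ainv ≈ 1# →
     (pow (ι a) m * bell m ainv
        ≈ - (Tr p (pow θ (τ p a)) * Tr p (powℤ θ θinv (+ m ℤ.- + 1 ℤ.- + τ p a))))
     × ((P Z : ℤ) → + kp p ∣ (P ℤ.* ((+ p) ℤ.^ a) ℤ.- + 1) →
        + kp p ∣ (Z ℤ.* (+ 1 ℤ.- P) ℤ.- + 1) →
        (Tr p (powℤ θ θinv Z) ≈ Tr p (pow θ (τ p a)))
        × (Tr p (pow θ (τ p a)) ≈ pow (ι a) (τ p a) * bell (τ p a) ainv))
theorem1p2 F zero    pr = contradiction pr ¬prime[0]
theorem1p2 F (suc n) pr field-F finite θ θinv θᵖ θθinv a m a⊥p ainv a-inverse =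
  trans (bell-trace a-inverse m) (-‿cong (*-congˡ (Tr-cong (sym (θ^-shift m))))) ,
  λ P Z kp∣P kp∣Z →
    trans (Tr-cong (θ^-ζ P Z kp∣P kp∣Z)) (Tr-φ Fixed-β a) ,
    bell-trace-τ a-inverse
  where
  open CommutativeRing F using (trans; sym; -‿cong; *-congˡ)
  open RingFacts F
  char = card-p^⇒char-p finite field-F (suc n) (suc n) ≡.refl
  open Characteristic pr char
  open ArtinSchreier pr char θ θinv θᵖ θθinv
  open Twist a a⊥p
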